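{- Let $(\Omega,S)$ be a 4-equivalenced association scheme with $|S|\ge 4$. If $\tau\in\mathrm{Aut}(\Omega,S)$ fixes two distinct points of $\Omega$, then $\tau$ is the identity map.
   Context: An association scheme $(\Omega,S)$: $\Omega$ finite, $S$ a partition of $\Omega\times\Omega$ containing $1_\Omega$, closed under transposition, with intersection numbers $c_{st}^r=|\{z:(x,z)\in s,(z,y)\in t\}|$ independent of $(x,y)\in r$; it is 4-equivalenced if every $s\neq1_\Omega$ has valency $c_{ss^*}^{1_\Omega}=4$. $\mathrm{Aut}(\Omega,S)=\{\sigma\in\mathrm{Sym}(\Omega):\mathrm{r}(\alpha,\beta)=\mathrm{r}(\alpha^\sigma,\beta^\sigma)\ \forall\alpha,\beta\}$, where $\mathrm{r}(\alpha,\beta)$ is the element of $S$ containing $(\alpha,\beta)$. -}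

module Defs where

open import Data.Nat using (ℕ; zero; suc; _+_; _≥_)
open import Data.Fin using (Fin; zero; suc) renaming (_≟_ to _≟ᶠ_)
open import Data.Product using (Σ; _×_; _,_; ∃)
open import Data.Bool using (if_then_else_)
open import Relation.Nullary using (¬_; does)
open import Relation.Binary.PropositionalEquality using (_≡_)
open import Function.Bundles using (_⇔_)
open import Function.Definitions using (Bijective)

open import Data.Bool using (Bool; true; false; _∧_)

cnt : (n : ℕ) → (Fin n → Bool) → ℕ
cnt zero    P = 0
cnt (suc n) P = (if P zero then 1 else 0) + cnt n (λ z → P (suc z))

-- An association scheme on Ω = Fin n with relation set S indexed by Fin d.
-- rel x y : the element r(x,y) of S containing (x,y).
record AssocScheme (n d : ℕ) : Set where
  field
    rel    : Fin n → Fin n → Fin d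
    nonempty : (s : Fin d) → Σ (Fin n) λ x → Σ (Fin n) λ y → rel x y ≡ s
    one    : Fin d
    one-diag : ∀ x y → (rel x y ≡ one) ⇔ (x ≡ y)
    trans* : Fin d → Fin d
    trans*-spec : ∀ x y → rel y x ≡ trans* (rel x y)
    inter : Fin d → Fin d → Fin d → ℕ
    inter-spec : ∀ s t r x y → rel x y ≡ r →
      cnt n (λ z → does (rel x z ≟ᶠ s) ∧ does (rel z y ≟ᶠ t)) ≡ inter s t r

  valency : Fin d → ℕ
  valency s = inter s (trans* s) one


FourEquivalenced : ∀ {n d} → AssocScheme n d → Set
FourEquivalenced S = ∀ s → ¬ (s ≡ one) → valency s ≡ 4
  where open AssocScheme S

IsAut : ∀ {n d} → AssocScheme n d → (Fin n → Fin n) → Set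
IsAut {n} S σ = Bijective {A = Fin n} {B = Fin n} _≡_ _≡_ σ × (∀ α β → rel α β ≡ rel (σ α) (σ β))
  where open AssocScheme S

{-# OPTIONS --safe #-}
module Submission where

-- Let μ s u be the number of sets x s containing a given u-related pair. It is at most 3 for u ≠ 1. If it is 3,
-- then s = u and the classes of {1, u} have five points; if it is 2, then every x s is a 4-cycle for u, as in the
-- lattice ℤ[i] with s = {±1, ±i} and u = (1 + i) s.
-- An automorphism with a fixed point has order dividing 12, so it suffices to consider τ of order 3 or 2.
-- If τ³ = 1, then every x s with x fixed contains a fixed point. For a moved by τ, all fixed points have the same
-- relation u to a, and μ u u = 3, so all fixed points lie in one class of {1, u}, although they meet every α s.
-- If τ² = 1, then some x s with x fixed contains two fixed and two moved points, and so μ s u ≥ 2 for some u.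
-- If μ s u = 2, then τ acts as a reflection of the lattice; since it preserves relations, the lattice is 3-periodic.
-- So in either case the fixed points x, f, f′ lie in a class of 5 or 9 points. The relations from x s = {f, f′, a, τ a}
-- to a point z outside this class can be compatible with τ only if f and f′ have different relations to z and
-- these are also the relations of a and τ a. Comparing this for the sets x s, f s and f′ s gives a contradiction.

open import Defs
import Algebra.Properties.Semiring.Sum as SemiringSum
open import Data.Bool using (Bool; true; false; if_then_else_)
open import Data.Empty using (⊥; ⊥-elim)
open import Data.Fin using (Fin; zero; suc) renaming (_≟_ to _≟ᶠ_)
import Data.Fin.Properties as Finₚ
open import Data.List using (List; []; _∷_; length)
import Data.List.Membership.DecPropositional as DecMembership
open import Data.List.Membership.Propositional using (_∈_; find; lose)
open import Data.List.Properties using (length-++)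
open import Data.List.Relation.Unary.All using (All; []; _∷_; all?; lookup; tail; uncons; zip) renaming (map to All-map)
import Data.List.Relation.Unary.All.Properties as Allₚ
open import Data.List.Relation.Unary.AllPairs using ([]; _∷_)
open import Data.List.Relation.Unary.Any using (any?; here; there)
open import Data.List.Relation.Unary.Any.Properties using (¬Any[])
open import Data.List.Relation.Unary.Unique.Propositional using (Unique)
import Data.List.Relation.Unary.Unique.Propositional.Properties as Uniqueₚ
open import Data.Nat using (ℕ; zero; suc; _+_; _*_; _≤_; _<_; _≥_; z≤n; s≤s)
open import Data.Nat.Divisibility using (_∣_; _∣0; ∣-refl; ∣1⇒≡1; ∣m∣n⇒∣m+n; ∣m+n∣m⇒∣n)
open import Data.Nat.Properties
open import Data.Product using (_×_; _,_; proj₁; proj₂; ∃; ∃₂)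
open import Data.Sum using (_⊎_; inj₁; inj₂; swap; [_,_]′) renaming (map to map-⊎)
open import Data.Unit using (⊤; tt)
open import Function using (_∘_)
open import Function.Bundles using (Equivalence; mk⇔)
open import Relation.Binary.PropositionalEquality
open import Relation.Nullary using (¬_; Dec; yes; no; does)
open import Relation.Nullary.Decidable using (_×-dec_; _⊎-dec_; ¬?; decidable-stable; dec-true; dec-false; does-⇔)
open import Relation.Unary using (Decidable)

-- Counting in finite sets.

module Sum = SemiringSum +-*-semiring
open Sum using (sum)

_∈?_ : ∀ {n} (z : Fin n) l → Dec (z ∈ l)
_∈?_ = DecMembership._∈?_ _≟ᶠ_

card : ∀ {n} {Q : Fin n → Set} → Decidable Q → ℕ
card {n} Q? = cnt n (does ∘ Q?)

indicator : Bool → ℕ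
indicator b = if b then 1 else 0

cnt≡sum : ∀ n P → cnt n P ≡ sum {n} (indicator ∘ P)
cnt≡sum zero    P = refl
cnt≡sum (suc n) P = cong (indicator (P zero) +_) (cnt≡sum n (P ∘ suc))

cnt-cong : ∀ n {P Q : Fin n → Bool} → (∀ z → P z ≡ Q z) → cnt n P ≡ cnt n Q
cnt-cong zero    P≗Q = refl
cnt-cong (suc n) P≗Q = cong₂ _+_ (cong indicator (P≗Q zero)) (cnt-cong n (P≗Q ∘ suc))

card-cong : ∀ {n} {Q R : Fin n → Set} (Q? : Decidable Q) (R? : Decidable R) →
            (∀ {z} → Q z → R z) → (∀ {z} → R z → Q z) → card Q? ≡ card R?
card-cong {n} Q? R? f g = cnt-cong n (λ z → does-⇔ (mk⇔ f g) (Q? z) (R? z))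

card-∅ : ∀ {n} {Q : Fin n → Set} (Q? : Decidable Q) → (∀ z → ¬ Q z) → card Q? ≡ 0
card-∅ {zero}  Q? ¬Q = refl
card-∅ {suc n} Q? ¬Q rewrite dec-false (Q? zero) (¬Q zero) = card-∅ (Q? ∘ suc) (¬Q ∘ suc)

_∖_ : ∀ {n} {Q : Fin n → Set} → Decidable Q → ∀ x → Decidable (λ z → Q z × z ≢ x)
(Q? ∖ x) z = Q? z ×-dec ¬? (z ≟ᶠ x)

card-∖ : ∀ {n} {Q : Fin n → Set} (Q? : Decidable Q) {x} → Q x → card Q? ≡ suc (card (Q? ∖ x))
card-∖ {suc n} Q? {zero} q rewrite dec-true (Q? zero) q =
  cong suc (card-cong (Q? ∘ suc) ((Q? ∖ zero) ∘ suc) (λ q → q , λ ()) proj₁)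
card-∖ {suc n} Q? {suc x} q = trans
  (cong₂ _+_ (cong indicator (does-⇔ (mk⇔ (λ q → q , λ ()) proj₁) (Q? zero) ((Q? ∖ suc x) zero)))
             (trans (card-∖ (Q? ∘ suc) q)
                    (cong suc (card-cong ((Q? ∘ suc) ∖ x) ((Q? ∖ suc x) ∘ suc)
                      (λ (q , z≢x) → q , z≢x ∘ Finₚ.suc-injective)
                      (λ (q , z≢x) → q , z≢x ∘ cong suc)))))
  (+-suc _ _)

length≤card : ∀ {n} {Q : Fin n → Set} (Q? : Decidable Q) {l} → Unique l → All Q l → length l ≤ card Q?
length≤card Q? []       []       = z≤n
length≤card Q? (x∉ ∷ u) (q ∷ qs) = ≤-trans
  (s≤s (length≤card (Q? ∖ _) u (zip (qs , All-map (λ x≢z → x≢z ∘ sym) x∉))))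
  (≤-reflexive (sym (card-∖ Q? q)))

card≤length : ∀ {n} {Q : Fin n → Set} (Q? : Decidable Q) l → (∀ z → Q z → z ∈ l) → card Q? ≤ length l
card≤length Q? []      Q⊆l = ≤-reflexive (card-∅ Q? (λ z q → ¬Any[] (Q⊆l z q)))
card≤length Q? (x ∷ l) Q⊆l = ≤-trans card≤ (s≤s (card≤length (Q? ∖ x) l (λ z (q , z≢x) → rest (Q⊆l z q) z≢x)))
  where
  rest : ∀ {z} → z ∈ (x ∷ l) → z ≢ x → z ∈ l
  rest (here z≡x)  z≢x = ⊥-elim (z≢x z≡x)
  rest (there z∈l) _   = z∈l
  card≤ : card Q? ≤ suc (card (Q? ∖ x))
  card≤ with Q? x
  ... | yes q = ≤-reflexive (card-∖ Q? q)
  ... | no ¬q = ≤-trans (≤-reflexive (card-cong Q? (Q? ∖ x) (λ q → q , λ { refl → ¬q q }) proj₁)) (n≤1+n _)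

abstract
  another : ∀ {n} {Q : Fin n → Set} (Q? : Decidable Q) l → length l < card Q? → ∃ λ z → Q z × All (z ≢_) l
  another Q? l l<c with Finₚ.any? (λ z → Q? z ×-dec all? (λ w → ¬? (z ≟ᶠ w)) l)
  ... | yes p = p
  ... | no ¬p = ⊥-elim (<⇒≱ l<c (card≤length Q? l (λ z q → decidable-stable (z ∈? l)
          (λ z∉l → ¬p (z , q , Allₚ.¬Any⇒All¬ l z∉l)))))

abstract
  choose : ∀ {n} {Q : Fin n → Set} (Q? : Decidable Q) m → m ≤ card Q? →
           ∃ λ l → length l ≡ m × Unique l × All Q l
  choose Q? zero    m≤c = [] , refl , [] , []
  choose Q? (suc m) m<c with choose Q? m (<⇒≤ m<c)
  ... | l , refl , u , qs with another Q? l m<c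
  ...   | z , q , z∉l = z ∷ l , refl , z∉l ∷ u , q ∷ qs

card-at : ∀ {n} (x : Fin n) → card (λ z → x ≟ᶠ z) ≡ 1
card-at x = trans (card-∖ (x ≟ᶠ_) refl)
                  (cong suc (card-∅ ((x ≟ᶠ_) ∖ x) (λ z (x≡z , z≢x) → z≢x (sym x≡z))))

sum-if : ∀ n (A : Fin n → Bool) c → sum {n} (λ i → if A i then c else 0) ≡ cnt n A * c
sum-if zero    A c = refl
sum-if (suc n) A c with A zero
... | true  = cong (c +_) (sum-if n (A ∘ suc) c)
... | false = sum-if n (A ∘ suc) c

cnt-swap : ∀ {m n} (M : Fin m → Fin n → Bool) →
           sum {m} (λ i → cnt n (M i)) ≡ sum {n} (λ j → cnt m (λ i → M i j))
cnt-swap {m} {n} M = begin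
  sum (λ i → cnt n (M i))                        ≡⟨ Sum.sum-cong-≗ (λ i → cnt≡sum n (M i)) ⟩
  sum (λ i → sum (λ j → indicator (M i j)))      ≡⟨ Sum.∑-comm (λ i j → indicator (M i j)) ⟩
  sum (λ j → sum (λ i → indicator (M i j)))      ≡⟨ Sum.sum-cong-≗ (λ j → cnt≡sum m (λ i → M i j)) ⟨
  sum (λ j → cnt m (λ i → M i j))                ∎
  where open ≡-Reasoning

-- Both sides are the number of `true` entries of `M`, added up by rows and by columns.
double-count : ∀ {m n} (M : Fin m → Fin n → Bool) (A : Fin m → Bool) (B : Fin n → Bool) {a b} →
  (∀ i → cnt n (M i) ≡ (if A i then a else 0)) →
  (∀ j → cnt m (λ i → M i j) ≡ (if B j then b else 0)) →
  cnt m A * a ≡ cnt n B * b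
double-count {m} {n} M A B {a} {b} rows columns = begin
  cnt m A * a                          ≡⟨ sum-if m A a ⟨
  sum (λ i → if A i then a else 0)     ≡⟨ Sum.sum-cong-≗ rows ⟨
  sum (λ i → cnt n (M i))              ≡⟨ cnt-swap M ⟩
  sum (λ j → cnt m (λ i → M i j))      ≡⟨ Sum.sum-cong-≗ columns ⟩
  sum (λ j → if B j then b else 0)     ≡⟨ sum-if n B b ⟩
  cnt n B * b                          ∎
  where open ≡-Reasoning

∣-sum : ∀ {k} n {f : Fin n → ℕ} → (∀ i → k ∣ f i) → k ∣ sum f
∣-sum zero    k∣f = _ ∣0
∣-sum (suc n) k∣f = ∣m∣n⇒∣m+n (k∣f zero) (∣-sum n (k∣f ∘ suc))

∣-card-fibres : ∀ {k n d} {Q : Fin n → Set} (Q? : Decidable Q) (f : Fin n → Fin d) →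
  (∀ i → k ∣ card (λ z → Q? z ×-dec (f z ≟ᶠ i))) → k ∣ card Q?
∣-card-fibres {k} {n} {d} {Q} Q? f k∣fibre = subst (k ∣_) (sym eq) (∣-sum d k∣fibre)
  where
  fibre : ∀ z → indicator (does (Q? z)) ≡ card (λ i → Q? z ×-dec (f z ≟ᶠ i))
  fibre z with Q? z
  ... | yes q = sym (trans (card-cong (λ i → yes q ×-dec (f z ≟ᶠ i)) (f z ≟ᶠ_) proj₂ (q ,_)) (card-at (f z)))
  ... | no ¬q = sym (card-∅ (λ i → no ¬q ×-dec (f z ≟ᶠ i)) (λ _ → ¬q ∘ proj₁))
  open ≡-Reasoning
  eq : card Q? ≡ sum (λ i → card (λ z → Q? z ×-dec (f z ≟ᶠ i)))
  eq = begin
    card Q?                                            ≡⟨ cnt≡sum n (does ∘ Q?) ⟩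
    sum (λ z → indicator (does (Q? z)))                ≡⟨ Sum.sum-cong-≗ fibre ⟩
    sum (λ z → card (λ i → Q? z ×-dec (f z ≟ᶠ i)))     ≡⟨ cnt-swap (λ z i → does (Q? z ×-dec (f z ≟ᶠ i))) ⟩
    sum (λ i → card (λ z → Q? z ×-dec (f z ≟ᶠ i)))     ∎

abstract
  -- Disjoint lists could be concatenated to a repetition-free list in `Q` longer than `card Q?`.
  share : ∀ {n} {Q : Fin n → Set} (Q? : Decidable Q) {l m} → Unique l → All Q l → Unique m → All Q m →
          card Q? < length l + length m → ∃ λ z → z ∈ l × z ∈ m
  share Q? {l} {m} ul ql um qm c< with any? (_∈? m) l
  ... | yes p = find p
  ... | no ¬p = ⊥-elim (<⇒≱ c< (≤-trans (≤-reflexive (sym (length-++ l)))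
    (length≤card Q? (Uniqueₚ.++⁺ ul um (λ (z∈l , z∈m) → ¬p (lose z∈l z∈m))) (Allₚ.++⁺ ql qm))))

too-many : ∀ {n k} {Q : Fin n → Set} (Q? : Decidable Q) {l} → card Q? ≡ k →
           Unique l → All Q l → k < length l → ⊥
too-many Q? refl u qs k<l = <⇒≱ k<l (length≤card Q? u qs)

card-all : ∀ m → card {m} {λ _ → ⊤} (λ _ → yes tt) ≡ m
card-all zero    = refl
card-all (suc m) = cong suc (card-all m)

-- Intersection numbers when all valencies are 4.

module FourEquivalencedScheme {n d} (S : AssocScheme n d) (four : FourEquivalenced S) where
  open AssocScheme S

  infix 10 _ᵗ
  _ᵗ : Fin d → Fin d
  _ᵗ = trans*

  rel-refl : ∀ x → rel x x ≡ one
  rel-refl x = Equivalence.from (one-diag x x) refl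

  rel-one : ∀ {x y} → rel x y ≡ one → x ≡ y
  rel-one = Equivalence.to (one-diag _ _)

  ≢⇒rel≢one : ∀ {x y} → x ≢ y → rel x y ≢ one
  ≢⇒rel≢one x≢y = x≢y ∘ rel-one

  rel⇒≢ : ∀ {x y s} → s ≢ one → rel x y ≡ s → x ≢ y
  rel⇒≢ s≢1 xy refl = s≢1 (trans (sym xy) (rel-refl _))

  flipped : ∀ {x y s} → rel x y ≡ s → rel y x ≡ s ᵗ
  flipped refl = trans*-spec _ _

  ᵗ-involutive : ∀ s → s ᵗ ᵗ ≡ s
  ᵗ-involutive s with nonempty s
  ... | _ , _ , refl = sym (flipped (flipped refl))

  unflipped : ∀ {x y s} → rel x y ≡ s ᵗ → rel y x ≡ s
  unflipped {s = s} xy = trans (flipped xy) (ᵗ-involutive s)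

  ᵗ-≢one : ∀ {s} → s ≢ one → s ᵗ ≢ one
  ᵗ-≢one {s} s≢1 sᵗ≡1 with nonempty s
  ... | x , y , refl with rel-one (trans (flipped refl) sᵗ≡1)
  ...   | refl = s≢1 (rel-refl x)

  separated : ∀ {x y z s t} → s ≢ t → rel x y ≡ s → rel x z ≡ t → y ≢ z
  separated s≢t xy xz refl = s≢t (trans (sym xy) xz)

  separated′ : ∀ {x y z s t} → s ≢ t → rel y x ≡ s → rel z x ≡ t → y ≢ z
  separated′ s≢t yx zx refl = s≢t (trans (sym yx) zx)

  out? : ∀ s x → Decidable (λ z → rel x z ≡ s)
  out? s x z = rel x z ≟ᶠ s

  between? : ∀ s t x y → Decidable (λ z → rel x z ≡ s × rel z y ≡ t)
  between? s t x y z = (rel x z ≟ᶠ s) ×-dec (rel z y ≟ᶠ t)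

  between-card : ∀ {x y r} s t → rel x y ≡ r → card (between? s t x y) ≡ inter s t r
  between-card s t xy = inter-spec s t _ _ _ xy

  out-card : ∀ {s} → s ≢ one → ∀ x → card (out? s x) ≡ 4
  out-card {s} s≢1 x = trans
    (card-cong (out? s x) (between? s (s ᵗ) x x) (λ xz → xz , flipped xz) proj₁)
    (trans (between-card s (s ᵗ) (rel-refl x)) (four s s≢1))

  inter-ᵗ : ∀ s t r → inter s t r ≡ inter (t ᵗ) (s ᵗ) (r ᵗ)
  inter-ᵗ s t r with nonempty r
  ... | x , y , xy = begin
    inter s t r                        ≡⟨ between-card s t xy ⟨
    card (between? s t x y)            ≡⟨ card-cong (between? s t x y) (between? (t ᵗ) (s ᵗ) y x)
                                            (λ (xz , zy) → flipped zy , flipped xz)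
                                            (λ (yz , zx) → unflipped zx , unflipped yz) ⟩
    card (between? (t ᵗ) (s ᵗ) y x)    ≡⟨ between-card (t ᵗ) (s ᵗ) (flipped xy) ⟩
    inter (t ᵗ) (s ᵗ) (r ᵗ)            ∎
    where open ≡-Reasoning

  row? : ∀ t r x f → Decidable (λ w → rel x w ≡ t × rel f w ≡ r)
  row? t r x f w = (rel x w ≟ᶠ t) ×-dec (rel f w ≟ᶠ r)

  row-card′ : ∀ {s x f} t r → rel x f ≡ s → card (row? t r x f) ≡ inter t (r ᵗ) s
  row-card′ {s} {x} {f} t r xf = trans
    (card-cong (row? t r x f) (between? t (r ᵗ) x f) (λ (xw , fw) → xw , flipped fw) (λ (xw , wf) → xw , unflipped wf))
    (between-card t (r ᵗ) xf)

  -- Count the r-edges between x s and x t from both ends; both have size 4.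
  inter-swap : ∀ {s t} r → s ≢ one → t ≢ one → inter t (r ᵗ) s ≡ inter s r t
  inter-swap {s} {t} r s≢1 t≢1 with nonempty s
  ... | x , _ , _ = *-cancelˡ-≡ _ _ 4 (begin
    4 * inter t (r ᵗ) s               ≡⟨ cong (_* inter t (r ᵗ) s) (out-card s≢1 x) ⟨
    card (out? s x) * inter t (r ᵗ) s ≡⟨ double-count (λ f w → does (edge? f w)) (does ∘ out? s x) (does ∘ out? t x) rows columns ⟩
    card (out? t x) * inter s r t     ≡⟨ cong (_* inter s r t) (out-card t≢1 x) ⟩
    4 * inter s r t                   ∎)
    where
    open ≡-Reasoning
    edge? : ∀ f w → Dec (rel x f ≡ s × rel x w ≡ t × rel f w ≡ r)
    edge? f w = out? s x f ×-dec row? t r x f w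
    rows : ∀ f → card (edge? f) ≡ (if does (out? s x f) then inter t (r ᵗ) s else 0)
    rows f with out? s x f
    ... | yes xf = trans (card-cong (λ w → yes xf ×-dec row? t r x f w) (row? t r x f) proj₂ (xf ,_)) (row-card′ t r xf)
    ... | no ¬xf = card-∅ (λ w → no ¬xf ×-dec row? t r x f w) (λ _ → ¬xf ∘ proj₁)
    columns : ∀ w → card (λ f → edge? f w) ≡ (if does (out? t x w) then inter s r t else 0)
    columns w with out? t x w
    ... | yes xw = trans (card-cong (λ f → out? s x f ×-dec (yes xw ×-dec (rel f w ≟ᶠ r))) (between? s r x w)
                           (λ (xf , _ , fw) → xf , fw) (λ (xf , fw) → xf , xw , fw))
                         (between-card s r xw)
    ... | no ¬xw = card-∅ (λ f → out? s x f ×-dec (no ¬xw ×-dec (rel f w ≟ᶠ r))) (λ _ (_ , xw , _) → ¬xw xw)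

  -- Together with `between-card`: in the matrix of relations between `x s` and `x t`, the entry `r`
  -- occurs `inter s r t` times in every row and in every column.
  row-card : ∀ {s t x f} r → s ≢ one → t ≢ one → rel x f ≡ s → card (row? t r x f) ≡ inter s r t
  row-card {t = t} r s≢1 t≢1 xf = trans (row-card′ t r xf) (inter-swap r s≢1 t≢1)

  -- μ s u is the valency of u on each set x s, and also the number of sets x s containing a given u-related pair.
  μ : Fin d → Fin d → ℕ
  μ s u = inter s u s

  common? : ∀ s y z → Decidable (λ w → rel w y ≡ s × rel w z ≡ s)
  common? s y z w = (rel w y ≟ᶠ s) ×-dec (rel w z ≟ᶠ s)

  -- One use of `inter-swap` passes from pairs to sets `x s`; the second removes the transpose left
  -- on `u`.
  common-card : ∀ {s u y z} → s ≢ one → u ≢ one → rel y z ≡ u → card (common? s y z) ≡ μ s u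
  common-card {s} {u} {y} {z} s≢1 u≢1 yz = begin
    card (common? s y z)          ≡⟨ card-cong (common? s y z) (between? (s ᵗ) s y z)
                                       (λ (wy , wz) → flipped wy , wz) (λ (yw , wz) → unflipped yw , wz) ⟩
    card (between? (s ᵗ) s y z)   ≡⟨ between-card (s ᵗ) s yz ⟩
    inter (s ᵗ) s u               ≡⟨ inter-swap s (ᵗ-≢one s≢1) u≢1 ⟨
    inter u (s ᵗ) (s ᵗ)           ≡⟨ inter-ᵗ u (s ᵗ) (s ᵗ) ⟩
    inter (s ᵗ ᵗ) (u ᵗ) (s ᵗ ᵗ)   ≡⟨ cong (λ q → inter q (u ᵗ) q) (ᵗ-involutive s) ⟩
    inter s (u ᵗ) s               ≡⟨ inter-swap u s≢1 s≢1 ⟩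
    μ s u                         ∎
    where open ≡-Reasoning

  shared? : ∀ s x x′ → Decidable (λ y → rel x y ≡ s × rel x′ y ≡ s)
  shared? s x x′ y = (rel x y ≟ᶠ s) ×-dec (rel x′ y ≟ᶠ s)

  shared-card : ∀ {s x x′ m} → s ≢ one → m ≢ one → rel x x′ ≡ m → card (shared? s x x′) ≡ μ (s ᵗ) m
  shared-card {s} {x} {x′} s≢1 m≢1 xx′ = trans
    (card-cong (shared? s x x′) (common? (s ᵗ) x x′) (λ (xy , x′y) → flipped xy , flipped x′y)
                                                     (λ (yx , yx′) → unflipped yx , unflipped yx′))
    (common-card (ᵗ-≢one s≢1) m≢1 xx′)

  -- A point `y` of the four-point set `x s` is not counted among its own `u`-predecessors.
  μ≤3 : ∀ {s u} → s ≢ one → u ≢ one → μ s u ≤ 3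
  μ≤3 {s} {u} s≢1 u≢1 = ≮⇒≥ (contra (proj₂ (proj₂ (nonempty s))))
    where
    contra : ∀ {x y} → rel x y ≡ s → ¬ (3 < μ s u)
    contra {x} {y} xy 3<μ =
      let l , len , uniq , all = choose (between? s u x y) 4 (subst (4 ≤_) (sym (between-card s u xy)) 3<μ)
      in too-many (out? s x) (out-card s≢1 x)
           (All-map (λ (_ , zy) → ≢-sym (rel⇒≢ u≢1 zy)) all ∷ uniq) (xy ∷ All-map proj₁ all)
           (subst (λ k → 4 < suc k) (sym len) ≤-refl)

  -- Common points are counted by `μ (s ᵗ) (rel x x′)`. This is used to show that `x s` and `x′ s`
  -- cannot coincide.
  no-twins : ∀ {s x x′ l} → s ≢ one → x ≢ x′ → Unique l → All (λ y → rel x y ≡ s × rel x′ y ≡ s) l → length l ≤ 3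
  no-twins {s} {x} {x′} s≢1 x≢x′ u qs = ≤-trans (length≤card (shared? s x x′) u qs)
    (≤-trans (≤-reflexive (shared-card s≢1 (≢⇒rel≢one x≢x′) refl)) (μ≤3 (ᵗ-≢one s≢1) (≢⇒rel≢one x≢x′)))

  -- Closed sets of relations.

  record Closed (K : Fin d → Set) : Set where
    field
      K?      : Decidable K
      K-one   : K one
      K-sym   : ∀ {x y} → K (rel x y) → K (rel y x)
      K-trans : ∀ {x y z} → K (rel x y) → K (rel y z) → K (rel x z)

  -- `Q` is a union of sets `x r` with `r` different from `one`, each of size 4.
  4∣saturated : ∀ {Q : Fin n → Set} (Q? : Decidable Q) x → ¬ Q x →
                (∀ {z z′} → rel x z ≡ rel x z′ → Q z → Q z′) → 4 ∣ card Q?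
  4∣saturated {Q} Q? x ¬Qx saturated = ∣-card-fibres Q? (rel x) fibre
    where
    fibre : ∀ r → 4 ∣ card (λ z → Q? z ×-dec (rel x z ≟ᶠ r))
    fibre r with Finₚ.any? (λ z → Q? z ×-dec (rel x z ≟ᶠ r))
    ... | no ¬p = subst (4 ∣_) (sym (card-∅ (λ z → Q? z ×-dec (rel x z ≟ᶠ r)) (λ z p → ¬p (z , p)))) (4 ∣0)
    ... | yes (z , q , xz) = subst (4 ∣_) (sym (trans
            (card-cong (λ w → Q? w ×-dec (rel x w ≟ᶠ r)) (out? r x) proj₂
                       (λ xw → saturated (trans xz (sym xw)) q , xw))
            (out-card r≢1 x))) ∣-refl
      where
      r≢1 : r ≢ one
      r≢1 refl with rel-one xz
      ... | refl = ¬Qx q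

  -- If x s lies in one class C of K, then C is a union of sets x r. Its size is 1 modulo 4
  -- when counted from a point of C, but 0 modulo 4 when counted from x, unless x is in C.
  absorb : ∀ {K} → Closed K → ∀ {s} → (∀ {x y z} → rel x y ≡ s → rel x z ≡ s → K (rel y z)) → K s
  absorb {K} closed {s} block = decidable-stable (K? s) λ ¬Ks → contra ¬Ks (nonempty s)
    where
    open Closed closed
    contra : ¬ K s → ∃₂ (λ x y → rel x y ≡ s) → ⊥
    contra ¬Ks (x , y , xy) with ∣1⇒≡1 (∣m+n∣m⇒∣n {4} {card (class? ∖ y)}
                                   (subst (4 ∣_) (trans (card-∖ class? y∈) (+-comm 1 _)) outside) inside)
      where
      class? : Decidable (λ z → K (rel y z))
      class? z = K? (rel y z)
      y∈ : K (rel y y)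
      y∈ = subst K (sym (rel-refl y)) K-one
      outside : 4 ∣ card class?
      outside = 4∣saturated class? x (λ Kyx → ¬Ks (subst K xy (K-sym Kyx))) saturated
        where
        saturated : ∀ {z z′} → rel x z ≡ rel x z′ → K (rel y z) → K (rel y z′)
        -- The path from `x` through `y` to `z` has a counterpart ending in `z′`, since its
        -- intersection number depends only on `rel x z`. By `block` the new middle point is in the
        -- class of `y`.
        saturated {z} {z′} xz≡ Kyz with another (between? s (rel y z) x z′) []
          (subst (0 <_) (trans (between-card s (rel y z) xz≡) (sym (between-card s (rel y z) refl)))
                 (length≤card (between? s (rel y z) x z) ([] ∷ []) ((xy , refl) ∷ [])))
        ... | y′ , (xy′ , y′z′) , _ = K-trans (block xy xy′) (subst K (sym y′z′) Kyz)
      inside : 4 ∣ card (class? ∖ y)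
      inside = 4∣saturated (class? ∖ y) y (λ (_ , y≢y) → y≢y refl)
        (λ yz≡ (Kyz , z≢y) → subst K yz≡ Kyz , λ { refl → z≢y (sym (rel-one (trans yz≡ (rel-refl y)))) })
    ... | ()

  -- The case `μ s u` = 3: cliques.

  in? : ∀ s y → Decidable (λ w → rel w y ≡ s)
  in? s y w = rel w y ≟ᶠ s

  in-card : ∀ {s} → s ≢ one → ∀ y → card (in? s y) ≡ 4
  in-card {s} s≢1 y = trans (card-cong (in? s y) (out? (s ᵗ) y) flipped unflipped) (out-card (ᵗ-≢one s≢1) y)

  out∖-card : ∀ {s x y} → s ≢ one → rel x y ≡ s → card (out? s x ∖ y) ≡ 3
  out∖-card {s} {x} s≢1 xy = suc-injective (trans (sym (card-∖ (out? s x) xy)) (out-card s≢1 x))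

  -- The three `u`-predecessors of `y` use up `x s` apart from `y`; a further `z` would be a fifth
  -- point.
  clique : ∀ {s u x y z} → s ≢ one → u ≢ one → μ s u ≡ 3 → rel x y ≡ s → rel x z ≡ s → z ≢ y → rel z y ≡ u
  clique {s} {u} {x} {y} {z} s≢1 u≢1 μ≡3 xy xz z≢y = decidable-stable (rel z y ≟ᶠ u) contra
    where
    contra : rel z y ≢ u → ⊥
    contra zy≢u =
      let l , len , uniq , all = choose (between? s u x y) 3 (≤-reflexive (sym (trans (between-card s u xy) μ≡3)))
      in too-many (out? s x) (out-card s≢1 x)
          ((z≢y ∷ All-map (λ (_ , wy) → λ { refl → zy≢u wy }) all)
           ∷ All-map (λ (_ , wy) → ≢-sym (rel⇒≢ u≢1 wy)) all ∷ uniq)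
          (xz ∷ xy ∷ All-map proj₁ all) (s≤s (s≤s (≤-reflexive (sym len))))

  One-or : Fin d → Fin d → Set
  One-or u r = r ≡ one ⊎ r ≡ u

  record Clique (u : Fin d) : Set where
    field
      ≢one      : u ≢ one
      symmetric : u ᵗ ≡ u
      triangle  : ∀ {f a b} → rel f a ≡ u → rel f b ≡ u → a ≢ b → rel a b ≡ u

    reverse : ∀ {x y} → rel x y ≡ u → rel y x ≡ u
    reverse xy = trans (flipped xy) symmetric

    closed : Closed (One-or u)
    closed = record
      { K?      = λ r → (r ≟ᶠ one) ⊎-dec (r ≟ᶠ u)
      ; K-one   = inj₁ refl
      ; K-sym   = K-sym
      ; K-trans = K-trans
      }
      where
      K-sym : ∀ {x y} → One-or u (rel x y) → One-or u (rel y x)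
      K-sym (inj₁ xy) with refl ← rel-one xy = inj₁ (rel-refl _)
      K-sym (inj₂ xy) = inj₂ (reverse xy)
      K-trans : ∀ {x y z} → One-or u (rel x y) → One-or u (rel y z) → One-or u (rel x z)
      K-trans (inj₁ xy) K-yz with refl ← rel-one xy = K-yz
      K-trans K-xy@(inj₂ _) (inj₁ yz) with refl ← rel-one yz = K-xy
      K-trans {x} {y} {z} (inj₂ xy) (inj₂ yz) with x ≟ᶠ z
      ... | yes refl = inj₁ (rel-refl x)
      ... | no  x≢z  = inj₂ (triangle (reverse xy) yz x≢z)

  μ≡3⇒clique : ∀ {s u} → s ≢ one → u ≢ one → μ s u ≡ 3 → s ≡ u × Clique u
  μ≡3⇒clique {s} {u} s≢1 u≢1 μ≡3 = s≡u , u-clique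
    where
    symmetric : u ᵗ ≡ u
    symmetric =
      let x , y , xy = nonempty s
          z , xz , z≢ = another (out? s x) (y ∷ []) (≤-trans (s≤s (s≤s z≤n)) (≤-reflexive (sym (out-card s≢1 x))))
          z≢y = lookup z≢ (here refl)
      in trans (sym (flipped (clique s≢1 u≢1 μ≡3 xy xz z≢y))) (clique s≢1 u≢1 μ≡3 xz xy (≢-sym z≢y))
    -- Two triples among the four sets containing f have a member in common.
    triangle : ∀ {f a b} → rel f a ≡ u → rel f b ≡ u → a ≢ b → rel a b ≡ u
    triangle {f} {a} {b} fa fb a≢b =
      let l , lenl , ul , ql = choose (common? s f a) 3 (≤-reflexive (sym (trans (common-card s≢1 u≢1 fa) μ≡3)))
          m , lenm , um , qm = choose (common? s f b) 3 (≤-reflexive (sym (trans (common-card s≢1 u≢1 fb) μ≡3)))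
          w , w∈l , w∈m = share (in? s f) ul (All-map proj₁ ql) um (All-map proj₁ qm)
            (subst₂ _<_ (sym (in-card s≢1 f)) (sym (cong₂ _+_ lenl lenm)) (m≤m+n 5 1))
      in clique s≢1 u≢1 μ≡3 (proj₂ (lookup qm w∈m)) (proj₂ (lookup ql w∈l)) a≢b
    u-clique : Clique u
    u-clique = record { ≢one = u≢1 ; symmetric = symmetric ; triangle = triangle }
    block : ∀ {x y z} → rel x y ≡ s → rel x z ≡ s → One-or u (rel y z)
    block {x} {y} {z} xy xz with y ≟ᶠ z
    ... | yes refl = inj₁ (rel-refl y)
    ... | no  y≢z  = inj₂ (clique s≢1 u≢1 μ≡3 xz xy y≢z)
    s≡u : s ≡ u
    -- Every `x s` lies in one class of {`one`, `u`}, so `s` itself belongs to this closed set.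
    s≡u with absorb (Clique.closed u-clique) block
    ... | inj₁ s≡1 = ⊥-elim (s≢1 s≡1)
    ... | inj₂ eq  = eq

  -- The case `μ s u` = 2: 4-cycles.

  -- Each x s is a 4-cycle for u whose two diagonals are v-related.
  record Quad (s u v : Fin d) : Set where
    field
      s≢1 : s ≢ one
      u≢1 : u ≢ one
      v≢1 : v ≢ one
      u≢v : u ≢ v
      u-symmetric : u ᵗ ≡ u
      v-symmetric : v ᵗ ≡ v
      μ-u : μ s u ≡ 2
      μ-v : μ s v ≡ 1
      cover : ∀ {x y z} → rel x y ≡ s → rel x z ≡ s → y ≢ z → rel y z ≡ u ⊎ rel y z ≡ v

    u-rev : ∀ {x y} → rel x y ≡ u → rel y x ≡ u
    u-rev xy = trans (flipped xy) u-symmetric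
    v-rev : ∀ {x y} → rel x y ≡ v → rel y x ≡ v
    v-rev xy = trans (flipped xy) v-symmetric

    one-v : ∀ {x y z w} → rel x y ≡ s → rel x z ≡ s → rel x w ≡ s → rel z y ≡ v → rel w y ≡ v → z ≢ w → ⊥
    one-v {x} {y} xy xz xw zy wy z≢w = too-many (between? s v x y) (trans (between-card s v xy) μ-v)
      ((z≢w ∷ []) ∷ [] ∷ []) ((xz , zy) ∷ (xw , wy) ∷ []) ≤-refl

    two-u : ∀ {x y z w t} → rel x y ≡ s → rel x z ≡ s → rel x w ≡ s → rel x t ≡ s →
            rel z y ≡ u → rel w y ≡ u → rel t y ≡ u → z ≢ w → z ≢ t → w ≢ t → ⊥
    two-u {x} {y} xy xz xw xt zy wy ty z≢w z≢t w≢t = too-many (between? s u x y) (trans (between-card s u xy) μ-u)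
      ((z≢w ∷ z≢t ∷ []) ∷ (w≢t ∷ []) ∷ [] ∷ []) ((xz , zy) ∷ (xw , wy) ∷ (xt , ty) ∷ []) ≤-refl

    -- An `m`-related pair inside some `x s` forces `m` to be `u` or `v`, and `μ s v` is only 1.
    μ≥2⇒u : ∀ {m} → m ≢ one → 2 ≤ μ s m → m ≡ u
    μ≥2⇒u {m} m≢1 2≤μ with nonempty m
    ... | y , z , yz with another (common? s y z) [] (≤-trans (s≤s z≤n) (≤-trans 2≤μ (≤-reflexive (sym (common-card s≢1 m≢1 yz)))))
    ...   | x , (xy , xz) , _ with cover xy xz (rel⇒≢ m≢1 yz)
    ...     | inj₁ yz≡u = trans (sym yz) yz≡u
    ...     | inj₂ yz≡v = ⊥-elim (<⇒≱ 2≤μ (≤-reflexive (trans (cong (μ s) (trans (sym yz) yz≡v)) μ-v)))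

    two-common : ∀ {y z p q} → y ≢ z → p ≢ q → rel p y ≡ s → rel p z ≡ s → rel q y ≡ s → rel q z ≡ s → rel y z ≡ u
    two-common {y} {z} y≢z p≢q py pz qy qz = μ≥2⇒u (≢⇒rel≢one y≢z)
      (≤-trans (length≤card (common? s y z) ((p≢q ∷ []) ∷ [] ∷ []) ((py , pz) ∷ (qy , qz) ∷ []))
               (≤-reflexive (common-card s≢1 (≢⇒rel≢one y≢z) refl)))

    three-common : ∀ {y z p q r} → y ≢ z → p ≢ q → p ≢ r → q ≢ r → rel p y ≡ s → rel p z ≡ s →
                   rel q y ≡ s → rel q z ≡ s → rel r y ≡ s → rel r z ≡ s → ⊥
    three-common {y} {z} y≢z p≢q p≢r q≢r py pz qy qz ry rz =
      too-many (common? s y z) (trans (common-card s≢1 u≢1 (two-common y≢z p≢q py pz qy qz)) μ-u)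
        ((p≢q ∷ p≢r ∷ []) ∷ (q≢r ∷ []) ∷ [] ∷ []) ((py , pz) ∷ (qy , qz) ∷ (ry , rz) ∷ []) ≤-refl

  -- u is symmetric because the two u-successors and the two u-predecessors of y
  -- lie among the three other points of x s.
  module QuadConstruction {s u} (s≢1 : s ≢ one) (u≢1 : u ≢ one) (μ≡2 : μ s u ≡ 2) where
    successors : ∀ {x y} → rel x y ≡ s → ∃ λ l → length l ≡ 2 × Unique l × All (λ w → rel x w ≡ s × rel y w ≡ u) l
    successors {x} {y} xy = choose (row? s u x y) 2 (≤-reflexive (sym (trans (row-card u s≢1 s≢1 xy) μ≡2)))

    predecessors : ∀ {x y} → rel x y ≡ s → ∃ λ l → length l ≡ 2 × Unique l × All (λ w → rel x w ≡ s × rel w y ≡ u) l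
    predecessors {x} {y} xy = choose (between? s u x y) 2 (≤-reflexive (sym (trans (between-card s u xy) μ≡2)))

    -- Pigeonhole: 2 + 2 exceeds the three points of `x s` other than `y`.
    coincide : ∀ {x y l m} → rel x y ≡ s → length l ≡ 2 → length m ≡ 2 → Unique l → All (λ w → rel x w ≡ s × w ≢ y) l →
              Unique m → All (λ w → rel x w ≡ s × w ≢ y) m → ∃ λ w → w ∈ l × w ∈ m
    coincide {x} {y} xy l≡ m≡ ul ql um qm = share (out? s x ∖ y) ul ql um qm
      (subst₂ _<_ (sym (out∖-card s≢1 xy)) (sym (cong₂ _+_ l≡ m≡)) ≤-refl)

    u-symmetric : u ᵗ ≡ u
    u-symmetric =
      let x , y , xy = nonempty s
          l , l≡ , ul , ql = predecessors xy
          m , m≡ , um , qm = successors xy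
          w , w∈l , w∈m = coincide xy l≡ m≡ ul (All-map (λ (xw , wy) → xw , rel⇒≢ u≢1 wy) ql)
                                          um (All-map (λ (xw , yw) → xw , ≢-sym (rel⇒≢ u≢1 yw)) qm)
      in trans (sym (flipped (proj₂ (lookup ql w∈l)))) (proj₂ (lookup qm w∈m))

    opposite : ∀ {x y} → rel x y ≡ s → ∃ λ o → rel x o ≡ s × o ≢ y × rel o y ≢ u
    opposite {x} {y} xy =
      let l , l≡ , ul , ql = predecessors xy
          o , xo , o≢ = another (out? s x) (y ∷ l) (subst₂ _<_ (sym (cong suc l≡)) (sym (out-card s≢1 x)) ≤-refl)
      in o , xo , lookup o≢ (here refl) , λ oy → too-many (between? s u x y) (trans (between-card s u xy) μ≡2)
           (tail o≢ ∷ ul) ((xo , oy) ∷ ql) (subst (λ k → 2 < suc k) (sym l≡) ≤-refl)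

    module _ {x y o} (xy : rel x y ≡ s) (xo : rel x o ≡ s) (o≢y : o ≢ y) (oy≢u : rel o y ≢ u) where
      v : Fin d
      v = rel o y

      v≢1 : v ≢ one
      v≢1 = ≢⇒rel≢one o≢y

      μ-v : μ s v ≡ 1
      μ-v = ≤-antisym (≮⇒≥ μ≤1)
        (subst (1 ≤_) (between-card s v xy) (length≤card (between? s v x y) ([] ∷ []) ((xo , refl) ∷ [])))
        where
        μ≤1 : ¬ (1 < μ s v)
        μ≤1 1<μ =
          let l , l≡ , ul , ql = predecessors xy
              m , m≡ , um , qm = choose (between? s v x y) 2 (subst (2 ≤_) (sym (between-card s v xy)) 1<μ)
              w , w∈l , w∈m = coincide xy l≡ m≡ ul (All-map (λ (xw , wy) → xw , rel⇒≢ u≢1 wy) ql)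
                                              um (All-map (λ (xw , wy) → xw , rel⇒≢ v≢1 wy) qm)
          in oy≢u (trans (sym (proj₂ (lookup qm w∈m))) (proj₂ (lookup ql w∈l)))

      -- Although `v` is read off from a single set, the counts `μ s u` = 2 and `μ s v` = 1 hold in
      -- every `x′ s`, and 2 + 1 exhausts the points other than `y′`.
      cover : ∀ {x′ y′ z} → rel x′ y′ ≡ s → rel x′ z ≡ s → y′ ≢ z → rel y′ z ≡ u ⊎ rel y′ z ≡ v
      cover {x′} {y′} {z} x′y′ x′z y′≢z with rel y′ z ≟ᶠ u | rel y′ z ≟ᶠ v
      ... | yes p | _     = inj₁ p
      ... | no  _ | yes q = inj₂ q
      ... | no ¬p | no ¬q = ⊥-elim (
        let l , l≡ , ul , ql = successors x′y′
            w , (x′w , y′w) , _ = another (row? s v x′ y′) []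
              (≤-reflexive (sym (trans (row-card v s≢1 s≢1 x′y′) μ-v)))
            t , t∈l , t∈m = coincide x′y′ l≡ refl
              ul (All-map (λ (x′t , y′t) → x′t , ≢-sym (rel⇒≢ u≢1 y′t)) ql)
              (((λ { refl → ¬q y′w }) ∷ []) ∷ [] ∷ [])
              ((x′z , ≢-sym y′≢z) ∷ (x′w , ≢-sym (rel⇒≢ v≢1 y′w)) ∷ [])
        in excluded y′w (proj₂ (lookup ql t∈l)) t∈m)
        where
        excluded : ∀ {w t} → rel y′ w ≡ v → rel y′ t ≡ u → ¬ (t ∈ z ∷ w ∷ [])
        excluded y′w y′t (here refl)         = ¬p y′t
        excluded y′w y′t (there (here refl)) = oy≢u (trans (sym y′w) y′t)

      v-symmetric : v ᵗ ≡ v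
      v-symmetric with cover xy xo (≢-sym o≢y)
      ... | inj₁ yo≡u = ⊥-elim (oy≢u (trans (flipped yo≡u) u-symmetric))
      ... | inj₂ yo≡v = trans (sym (flipped refl)) yo≡v

    abstract
      quad : ∃ (Quad s u)
      quad =
        let x , y , xy = nonempty s
            o , xo , o≢y , oy≢u = opposite xy
        in rel o y , record
          { s≢1 = s≢1 ; u≢1 = u≢1 ; v≢1 = v≢1 xy xo o≢y oy≢u ; u≢v = ≢-sym oy≢u
          ; u-symmetric = u-symmetric ; v-symmetric = v-symmetric xy xo o≢y oy≢u
          ; μ-u = μ≡2 ; μ-v = μ-v xy xo o≢y oy≢u ; cover = cover xy xo o≢y oy≢u
          }

  -- The dichotomy and its consequences.

  abstract
    μ-dichotomy : ∀ {s u} → s ≢ one → u ≢ one → 2 ≤ μ s u → (s ≡ u × Clique u) ⊎ ∃ (Quad s u)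
    μ-dichotomy {s} {u} s≢1 u≢1 2≤μ with μ s u ≟ 3
    ... | yes μ≡3 = inj₁ (μ≡3⇒clique s≢1 u≢1 μ≡3)
    ... | no  μ≢3 = inj₂ (QuadConstruction.quad s≢1 u≢1
                      (≤-antisym (≤-pred (≤∧≢⇒< (μ≤3 s≢1 u≢1) μ≢3)) 2≤μ))

  abstract
    -- In the clique case `s` would equal `m`, and all pairs inside `x s` would be `m`-related; but
    -- both `u` and `v` occur there.
    quad-ᵗ : ∀ {s u v m} → Quad s u v → m ≢ one → 2 ≤ μ (s ᵗ) m → ∃ (Quad (s ᵗ) m)
    quad-ᵗ {s} {u} {v} {m} quad m≢1 2≤μ with μ-dichotomy (ᵗ-≢one s≢1) m≢1 2≤μ
      where open Quad quad
    ... | inj₂ quad′ = quad′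
    ... | inj₁ (sᵗ≡m , m-clique) = ⊥-elim (u≢v (trans (sym (pair μ-u (s≤s z≤n) u≢1)) (pair μ-v ≤-refl v≢1)))
      where
      open Quad quad
      s≡m : s ≡ m
      s≡m = trans (sym (ᵗ-involutive s)) (trans (cong _ᵗ sᵗ≡m) (Clique.symmetric m-clique))
      pair : ∀ {r k} → μ s r ≡ k → 1 ≤ k → r ≢ one → m ≡ r
      pair {r} μ≡k 1≤k r≢1 =
        let x , y , xy = nonempty s
            z , (xz , zy) , _ = another (between? s r x y) [] (subst (1 ≤_) (sym (trans (between-card s r xy) μ≡k)) 1≤k)
        in trans (sym (Clique.triangle m-clique (trans xz s≡m) (trans xy s≡m) (rel⇒≢ r≢1 zy))) zy

  abstract
    -- The ends of a diagonal of the 4-cycle `x s` are both `u`-related to the two other vertices,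
    -- so `μ u v` is at least 2. In the lattice this step is multiplication by 1 + i.
    next-quad : ∀ {s u v} → Quad s u v → ∃ (Quad u v)
    next-quad {s} {u} {v} quad = [ (λ (u≡v , _) → ⊥-elim (u≢v u≡v)) , (λ quad′ → quad′) ]′ (μ-dichotomy u≢1 v≢1 2≤μ)
      where
      open Quad quad
      side : ∀ {x y o p} → rel x y ≡ s → rel x o ≡ s → rel y o ≡ v → rel x p ≡ s → rel y p ≡ u → rel p o ≡ u
      side xy xo yo xp yp with cover xp xo (separated u≢v yp yo)
      ... | inj₁ po = po
      ... | inj₂ po = ⊥-elim (one-v xo xp xy po yo (≢-sym (rel⇒≢ u≢1 yp)))
      2≤μ : 2 ≤ μ u v
      2≤μ =
        let x , y , xy = nonempty s
            o , (xo , yo) , _ = another (row? s v x y) [] (≤-reflexive (sym (trans (row-card v s≢1 s≢1 xy) μ-v)))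
            l , l≡ , ul , ql = choose (row? s u x y) 2 (≤-reflexive (sym (trans (row-card u s≢1 s≢1 xy) μ-u)))
        in subst₂ _≤_ l≡ (common-card u≢1 v≢1 yo)
             (length≤card (common? u y o) ul (All-map (λ (xp , yp) → u-rev yp , side xy xo yo xp yp) ql))

  abstract
    escape : ∀ x rs → suc (length rs) < d → ∃ λ z → rel x z ≢ one × All (rel x z ≢_) rs
    escape x rs len<d =
      let r , _ , r≢ = another {d} (λ _ → yes tt) (one ∷ rs) (subst (suc (length rs) <_) (sym (card-all d)) len<d)
          r≢1 , r∉rs = uncons r≢
          z , xz , _ = another (out? r x) [] (subst (0 <_) (sym (out-card r≢1 x)) (s≤s z≤n))
      in z , subst (_≢ one) (sym xz) r≢1 , subst (λ q → All (q ≢_) rs) (sym xz) r∉rs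

  abstract
    -- The two common points give `μ (k ᵗ) e` at least 2, where `e` is `rel y y′`. In the clique
    -- case `k ᵗ` is `e`. In the quad case `v` is in `K` too, because `next-quad` finds a
    -- `v`-related pair inside a set `x e`; so every set `p (k ᵗ)` lies in one class, and `absorb`
    -- applies.
    thin : ∀ {K} → Closed K → ∀ {y y′ z w k} → K (rel y y′) → y ≢ y′ → z ≢ w →
           rel y z ≡ k → rel y′ z ≡ k → rel y w ≡ k → rel y′ w ≡ k → K k
    thin {K} closed {y} {y′} {z} {w} {k} K-yy′ y≢y′ z≢w yz y′z yw y′w with k ≟ᶠ one
    ... | yes refl = Closed.K-one closed
    ... | no  k≢1  = transpose (μ-dichotomy (ᵗ-≢one k≢1) e≢1 2≤μ)
      where
      open Closed closed
      e : Fin d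
      e = rel y y′
      e≢1 : e ≢ one
      e≢1 = ≢⇒rel≢one y≢y′
      2≤μ : 2 ≤ μ (k ᵗ) e
      2≤μ = subst (2 ≤_) (shared-card k≢1 e≢1 refl)
        (length≤card (shared? k y y′) ((z≢w ∷ []) ∷ [] ∷ []) ((yz , y′z) ∷ (yw , y′w) ∷ []))
      K-ᵗ : K (k ᵗ) → K k
      K-ᵗ K-kᵗ = subst K yz (K-sym (subst K (sym (flipped yz)) K-kᵗ))
      K-v : ∀ {v} → Quad (k ᵗ) e v → K v
      K-v {v} quad =
        let w , next = next-quad quad
            x , y , xy = nonempty e
            z , (xz , zy) , _ = another (between? e v x y) []
              (subst (0 <_) (sym (trans (between-card e v xy) (Quad.μ-u next))) (s≤s z≤n))
        in subst K zy (K-trans (K-sym (subst K (sym xz) K-yy′)) (subst K (sym xy) K-yy′))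
      transpose : (k ᵗ ≡ e × Clique e) ⊎ ∃ (Quad (k ᵗ) e) → K k
      transpose (inj₁ (kᵗ≡e , _))  = K-ᵗ (subst K (sym kᵗ≡e) K-yy′)
      transpose (inj₂ (v , quad)) = K-ᵗ (absorb closed block)
        where
        block : ∀ {p q r} → rel p q ≡ k ᵗ → rel p r ≡ k ᵗ → K (rel q r)
        block {p} {q} {r} pq pr with q ≟ᶠ r
        ... | yes refl = subst K (sym (rel-refl q)) K-one
        ... | no  q≢r with Quad.cover quad pq pr q≢r
        ...   | inj₁ qr = subst K (sym qr) K-yy′
        ...   | inj₂ qr = subst K (sym qr) (K-v quad)

  -- Automorphisms with fixed points.

  module Automorphism (τ : Fin n → Fin n) (τ-injective : ∀ {x y} → τ x ≡ τ y → x ≡ y)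
                      (τ-rel : ∀ x y → rel (τ x) (τ y) ≡ rel x y) where

    Fixed Moved : Fin n → Set
    Fixed x = τ x ≡ x
    Moved x = ¬ Fixed x

    fixed≢moved : ∀ {x y} → Fixed x → Moved y → x ≢ y
    fixed≢moved fx my refl = my fx

    rel-from-fixed : ∀ {x y s} → Fixed x → rel x y ≡ s → rel x (τ y) ≡ s
    rel-from-fixed {x} {y} fx xy = trans (trans (cong (λ w → rel w (τ y)) (sym fx)) (τ-rel x y)) xy

    rel-to-fixed : ∀ {x y s} → Fixed y → rel x y ≡ s → rel (τ x) y ≡ s
    rel-to-fixed {x} {y} fy xy = trans (trans (cong (rel (τ x)) (sym fy)) (τ-rel x y)) xy

    τ²-≢ : ∀ {x} → Moved x → τ (τ x) ≢ τ x
    τ²-≢ mx eq = mx (τ-injective eq)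

    -- Automorphisms with trivial cube.

    module Order3 (cube : ∀ x → τ (τ (τ x)) ≡ x) where
      τ²-≢id : ∀ {x} → Moved x → τ (τ x) ≢ x
      τ²-≢id {x} mx eq = mx (trans (cong τ (sym eq)) (cube x))

      abstract
        -- The orbits on the four points of `x r` have size 1 or 3. If `b` is moved, its orbit
        -- leaves one point `w`, whose image has nowhere else to go.
        fixed-neighbour : ∀ {x r} → Fixed x → r ≢ one → ∃ λ δ → rel x δ ≡ r × Fixed δ
        fixed-neighbour {x} {r} fx r≢1 with another (out? r x) [] (subst (0 <_) (sym (out-card r≢1 x)) (s≤s z≤n))
        ... | b , xb , _ with τ b ≟ᶠ b
        ...   | yes fb = b , xb , fb
        ...   | no  mb with another (out? r x) (b ∷ τ b ∷ τ (τ b) ∷ []) (subst (3 <_) (sym (out-card r≢1 x)) ≤-refl)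
        ...     | w , xw , w≢b ∷ w≢τb ∷ w≢τ²b ∷ [] = w , xw , decidable-stable (τ w ≟ᶠ w) λ mw →
          too-many (out? r x) (out-card r≢1 x)
            ((≢-sym mw ∷ w≢b ∷ w≢τb ∷ w≢τ²b ∷ [])
             ∷ ((λ τw≡b → w≢τ²b (trans (sym (cube w)) (cong (τ ∘ τ) τw≡b)))
                ∷ w≢b ∘ τ-injective ∷ w≢τb ∘ τ-injective ∷ [])
             ∷ (≢-sym mb ∷ ≢-sym (τ²-≢id mb) ∷ []) ∷ (≢-sym (τ²-≢ mb) ∷ []) ∷ [] ∷ [])
            (xw ∷ rel-from-fixed fx xw ∷ xb ∷ rel-from-fixed fx xb ∷ rel-from-fixed fx (rel-from-fixed fx xb) ∷ [])
            ≤-refl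

      -- For a fixed x, the set x (rel x a) consists of the orbit of a and a fixed point f
      -- that is related to all of the orbit in the same way.
      to-moved : ∀ {x a} → Fixed x → Moved a → Clique (rel a (τ a)) × rel x a ≡ rel a (τ a)
      to-moved {x} {a} fx ma =
        let f , xf , ff = fixed-neighbour fx (≢⇒rel≢one (fixed≢moved fx ma))
        in uniform xf ff (≢-sym (fixed≢moved ff ma))
        where
        s = rel x a
        s≢1 : s ≢ one
        s≢1 = ≢⇒rel≢one (fixed≢moved fx ma)
        uniform : ∀ {f} → rel x f ≡ s → Fixed f → a ≢ f → Clique (rel a (τ a)) × s ≡ rel a (τ a)
        uniform {f} xf ff a≢f = subst Clique s≡aτa s-clique , s≡aτa
          where
          u = rel a f
          μ≡3 : μ s u ≡ 3
          μ≡3 = ≤-antisym (μ≤3 s≢1 (≢⇒rel≢one a≢f)) (subst (3 ≤_) (between-card s u xf)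
            (length≤card (between? s u x f) ((≢-sym ma ∷ ≢-sym (τ²-≢id ma) ∷ []) ∷ (≢-sym (τ²-≢ ma) ∷ []) ∷ [] ∷ [])
              ((refl , refl) ∷ (rel-from-fixed fx refl , rel-to-fixed ff refl)
               ∷ (rel-from-fixed fx (rel-from-fixed fx refl) , rel-to-fixed ff (rel-to-fixed ff refl)) ∷ [])))
          s≡u×clique = μ≡3⇒clique s≢1 (≢⇒rel≢one a≢f) μ≡3
          s-clique : Clique s
          s-clique = subst Clique (sym (proj₁ s≡u×clique)) (proj₂ s≡u×clique)
          s≡aτa : s ≡ rel a (τ a)
          s≡aτa = sym (Clique.triangle s-clique refl (rel-from-fixed fx refl) (≢-sym ma))

      -- The relation `rel a (τ a)` does not involve the fixed point, so any two fixed points are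
      -- equal or related by it; yet `escape` and `fixed-neighbour` produce a fixed `δ` related to
      -- `α` otherwise.
      all-fixed : d ≥ 4 → ∀ {α} → Fixed α → ∀ a → Fixed a
      all-fixed d≥4 {α} fα a = decidable-stable (τ a ≟ᶠ a) λ ma →
        let open Clique (proj₁ (to-moved fα ma))
            z , αz≢1 , αz≢ = escape α (rel a (τ a) ∷ []) (≤-trans (n≤1+n 3) d≥4)
            δ , αδ , fδ = fixed-neighbour fα αz≢1
        in lookup αz≢ (here refl) (trans (sym αδ)
             (triangle (reverse (proj₂ (to-moved fα ma))) (reverse (proj₂ (to-moved fδ ma)))
                       (rel⇒≢ αz≢1 αδ)))

    -- Involutions: sets with two fixed and two moved points.

    module Order2 (involutive : ∀ x → τ (τ x) ≡ x) where
      moved-image : ∀ {x} → Moved x → Moved (τ x)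
      moved-image = τ²-≢

      image≢ : ∀ {x y} → x ≢ τ y → τ x ≢ y
      image≢ x≢τy τx≡y = x≢τy (trans (sym (involutive _)) (cong τ τx≡y))

      moved-pair : ∀ {x y} → Moved y → x ≢ y → x ≢ τ y → Moved x → Unique (x ∷ τ x ∷ y ∷ τ y ∷ [])
      moved-pair my x≢y x≢τy mx = (≢-sym mx ∷ x≢y ∷ x≢τy ∷ []) ∷ (image≢ x≢τy ∷ x≢y ∘ τ-injective ∷ [])
                                  ∷ (≢-sym my ∷ []) ∷ [] ∷ []

      fixed-∷ : ∀ {x l} → Fixed x → All Moved l → All (x ≢_) l
      fixed-∷ fx = All-map (fixed≢moved fx)

      module _ {x s} (s≢1 : s ≢ one) (fx : Fixed x) where
        -- The name lists orbit sizes, here and in `no-1+1+1+2`: they add up to five points in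
        -- `x s`.
        no-1+2+2 : ∀ {p q r} → rel x p ≡ s → rel x q ≡ s → rel x r ≡ s → Fixed p → Moved q → Moved r →
                   q ≢ r → q ≢ τ r → ⊥
        no-1+2+2 xp xq xr fp mq mr q≢r q≢τr = too-many (out? s x) (out-card s≢1 x)
          (fixed-∷ fp (mq ∷ moved-image mq ∷ mr ∷ moved-image mr ∷ []) ∷ moved-pair mr q≢r q≢τr mq)
          (xp ∷ xq ∷ rel-from-fixed fx xq ∷ xr ∷ rel-from-fixed fx xr ∷ []) ≤-refl

        no-1+1+1+2 : ∀ {p q r w} → rel x p ≡ s → rel x q ≡ s → rel x r ≡ s → rel x w ≡ s →
                     Fixed p → Fixed q → Fixed r → Moved w → p ≢ q → p ≢ r → q ≢ r → ⊥
        no-1+1+1+2 xp xq xr xw fp fq fr mw p≢q p≢r q≢r = too-many (out? s x) (out-card s≢1 x)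
          ((p≢q ∷ p≢r ∷ fixed-∷ fp pair) ∷ (q≢r ∷ fixed-∷ fq pair) ∷ fixed-∷ fr pair ∷ (≢-sym mw ∷ []) ∷ [] ∷ [])
          (xp ∷ xq ∷ xr ∷ xw ∷ rel-from-fixed fx xw ∷ []) ≤-refl
          where
          pair = mw ∷ moved-image mw ∷ []

        abstract
          same-pair : ∀ {p q r} → rel x p ≡ s → rel x q ≡ s → rel x r ≡ s → Fixed p → Moved q → Moved r → r ≡ q ⊎ r ≡ τ q
          same-pair {p} {q} {r} xp xq xr fp mq mr with r ≟ᶠ q | r ≟ᶠ τ q
          ... | yes r≡q | _        = inj₁ r≡q
          ... | no  _   | yes r≡τq = inj₂ r≡τq
          ... | no  r≢q | no  r≢τq = ⊥-elim (no-1+2+2 xp xr xq fp mr mq r≢q r≢τq)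

      record Mixed (s : Fin d) (x f f′ a : Fin n) : Set where
        field
          s≢1 : s ≢ one
          fixed-x : Fixed x
          fixed-f : Fixed f
          fixed-f′ : Fixed f′
          moved-a : Moved a
          f≢f′ : f ≢ f′
          xf : rel x f ≡ s
          xf′ : rel x f′ ≡ s
          xa : rel x a ≡ s

        xτa : rel x (τ a) ≡ s
        xτa = rel-from-fixed fixed-x xa

        abstract
          -- Were `w` fixed, it would be a third fixed point beside the orbit of `a`.
          pair : ∀ {w} → rel x w ≡ s → w ≢ f → w ≢ f′ → w ≡ a ⊎ w ≡ τ a
          pair {w} xw w≢f w≢f′ = same-pair s≢1 fixed-x xf xa xw fixed-f moved-a
            λ fw → no-1+1+1+2 s≢1 fixed-x xw xf xf′ xa fw fixed-f fixed-f′ moved-a w≢f w≢f′ f≢f′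

        exchange : Mixed s x f′ f a
        exchange = record { s≢1 = s≢1 ; fixed-x = fixed-x ; fixed-f = fixed-f′ ; fixed-f′ = fixed-f
                          ; moved-a = moved-a ; f≢f′ = ≢-sym f≢f′ ; xf = xf′ ; xf′ = xf ; xa = xa }

      abstract
        mixed : ∀ {s x f a} → Fixed x → Fixed f → Moved a → rel x f ≡ s → rel x a ≡ s → ∃ λ f′ → Mixed s x f f′ a
        mixed {s} {x} {f} {a} fx ff ma xf xa =
          let f′ , xf′ , f′≢ = another (out? s x) (f ∷ a ∷ τ a ∷ []) (subst (3 <_) (sym (out-card s≢1 x)) ≤-refl)
              f′≢a  = lookup f′≢ (there (here refl))
              f′≢τa = lookup f′≢ (there (there (here refl)))
          in f′ , record
            { s≢1 = s≢1 ; fixed-x = fx ; fixed-f = ff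
            ; fixed-f′ = decidable-stable (τ f′ ≟ᶠ f′) (λ mf′ → no-1+2+2 s≢1 fx xf xf′ xa ff mf′ ma f′≢a f′≢τa)
            ; moved-a = ma ; f≢f′ = ≢-sym (lookup f′≢ (here refl)) ; xf = xf ; xf′ = xf′ ; xa = xa }
          where
          s≢1 : s ≢ one
          s≢1 refl = fixed≢moved fx ma (rel-one xa)

      -- Relations from a mixed set to points outside its class.

      -- The relations between x s = {f, f′, a, τ a} and x t form a matrix in which each relation
      -- has the same number of entries in every row and column; by `thin` two rows
      -- agree in at most one column for each relation.
      module Transversal {K} (closed : Closed K) {s x f f′ a} (m : Mixed s x f f′ a) (K-s : K s) where
        open Closed closed
        open Mixed m

        module _ {t} (¬K-t : ¬ K t) where
          t≢1 : t ≢ one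
          t≢1 refl = ¬K-t K-one

          -- By `thin` the repeated entry `r` would be in `K`, and then so would `t`, on the way
          -- through `g`.
          thin-rows : ∀ {g h w w′ r} → rel x g ≡ s → rel x h ≡ s → rel x w ≡ t → g ≢ h → w ≢ w′ →
                      rel g w ≡ r → rel h w ≡ r → rel g w′ ≡ r → rel h w′ ≡ r → ⊥
          thin-rows xg xh xw g≢h w≢w′ gw hw gw′ hw′ = ¬K-t (subst K xw (K-trans (subst K (sym xg) K-s)
            (subst K (sym gw) (thin closed (K-trans (K-sym (subst K (sym xg) K-s)) (subst K (sym xh) K-s))
                                     g≢h w≢w′ gw hw gw′ hw′))))

          row-bound : ∀ {g l} r → rel x g ≡ s → Unique l → All (λ w → rel x w ≡ t × rel g w ≡ r) l →
                      length l ≤ inter s r t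
          row-bound {g} r xg u qs = ≤-trans (length≤card (row? t r x g) u qs) (≤-reflexive (row-card r s≢1 t≢1 xg))

          column-bound : ∀ {w l} r → rel x w ≡ t → Unique l → All (λ g → rel x g ≡ s × rel g w ≡ r) l →
                         length l ≤ inter s r t
          column-bound {w} r xw u qs = ≤-trans (length≤card (between? s r x w) u qs) (≤-reflexive (between-card s r xw))

          more-in-row : ∀ {g} r l → rel x g ≡ s → length l < inter s r t →
                        ∃ λ w → (rel x w ≡ t × rel g w ≡ r) × All (w ≢_) l
          more-in-row {g} r l xg len = another (row? t r x g) l (subst (length l <_) (sym (row-card r s≢1 t≢1 xg)) len)

          more-in-column : ∀ {w} r l → rel x w ≡ t → length l < inter s r t →
                           ∃ λ g → (rel x g ≡ s × rel g w ≡ r) × All (g ≢_) l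
          more-in-column {w} r l xw len = another (between? s r x w) l (subst (length l <_) (sym (between-card s r xw)) len)

          column-twice : ∀ {z} → rel x z ≡ t → Fixed z → 1 < inter s (rel a z) t
          column-twice {z} xz fz = column-bound (rel a z) xz ((≢-sym moved-a ∷ []) ∷ [] ∷ [])
            ((xa , refl) ∷ (xτa , rel-to-fixed fz refl) ∷ [])

          -- Rows `a` and `τ a` share the entry `r` in the fixed column `z₀`, hence in no other. So
          -- `z` is moved, `r` occurs exactly twice in each row and column, and in column `z₀` only
          -- in these two rows. This forces `r` into columns `z` and `τ z` of both rows `f` and
          -- `f′`, against `thin-rows`.
          module FixedColumn {z₀ z r} (xz₀ : rel x z₀ ≡ t) (fz₀ : Fixed z₀) (xz : rel x z ≡ t) (z≢z₀ : z ≢ z₀)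
                             (az₀ : rel a z₀ ≡ r) (az : rel a z ≡ r) where
            τaz₀ : rel (τ a) z₀ ≡ r
            τaz₀ = rel-to-fixed fz₀ az₀

            mz : Moved z
            mz fz = thin-rows xa xτa xz (≢-sym moved-a) z≢z₀ az (rel-to-fixed fz az) az₀ τaz₀

            inter≤2 : ¬ (2 < inter s r t)
            inter≤2 2<i =
              let w , (xw , aw) , w≢ = more-in-row r (z₀ ∷ z ∷ []) xa 2<i
                  w≢z₀ , w≢[z] = uncons w≢
              in third xw aw w≢z₀ (lookup w≢[z] (here refl))
              where
              third : ∀ {w} → rel x w ≡ t → rel a w ≡ r → w ≢ z₀ → w ≢ z → ⊥
              third {w} xw aw w≢z₀ w≢z = cases (same-pair t≢1 fixed-x xz₀ xz xw fz₀ mz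
                (λ fw → thin-rows xa xτa xw (≢-sym moved-a) w≢z₀ aw (rel-to-fixed fw aw) az₀ τaz₀))
                where
                cases : w ≡ z ⊎ w ≡ τ z → ⊥
                cases (inj₁ w≡z)  = w≢z w≡z
                cases (inj₂ refl) = thin-rows xa xτa xz (≢-sym moved-a) z≢z₀ az
                  (subst (λ v → rel (τ a) v ≡ r) (involutive z) (trans (τ-rel a (τ z)) aw)) az₀ τaz₀

            module _ {g} (xg : rel x g ≡ s) (fg : Fixed g) where
              gz₀≢r : rel g z₀ ≢ r
              gz₀≢r gz₀ = inter≤2 (column-bound r xz₀
                (fixed-∷ fg (moved-a ∷ moved-image moved-a ∷ []) ∷ (≢-sym moved-a ∷ []) ∷ [] ∷ [])
                ((xg , gz₀) ∷ (xa , az₀) ∷ (xτa , τaz₀) ∷ []))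

              moved-entry : ∀ {w} → rel x w ≡ t → rel g w ≡ r → Moved w → rel g z ≡ r
              moved-entry {w} xw gw mw = cases (same-pair t≢1 fixed-x xz₀ xz xw fz₀ mz mw)
                where
                cases : w ≡ z ⊎ w ≡ τ z → rel g z ≡ r
                cases (inj₁ refl) = gw
                cases (inj₂ refl) = subst (λ v → rel g v ≡ r) (involutive z) (rel-from-fixed fg gw)

              -- One of the two entries `r` in row `g` is in a moved column; otherwise these columns
              -- and `z₀` would be three fixed points beside the orbit of `z`.
              fixed-row : rel g z ≡ r
              fixed-row =
                let p , (xp , gp) , _   = more-in-row r [] xg (≤-trans (s≤s z≤n) twice)
                    q , (xq , gq) , q≢p = more-in-row r (p ∷ []) xg twice
                in cases xp gp xq gq (lookup q≢p (here refl)) (τ p ≟ᶠ p) (τ q ≟ᶠ q)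
                where
                twice : 1 < inter s r t
                twice = subst (λ r → 1 < inter s r t) az₀ (column-twice xz₀ fz₀)
                cases : ∀ {p q} → rel x p ≡ t → rel g p ≡ r → rel x q ≡ t → rel g q ≡ r → q ≢ p →
                        Dec (Fixed p) → Dec (Fixed q) → rel g z ≡ r
                cases xp gp xq gq q≢p (no mp)  _        = moved-entry xp gp mp
                cases xp gp xq gq q≢p (yes _)  (no mq)  = moved-entry xq gq mq
                cases xp gp xq gq q≢p (yes fp) (yes fq) = ⊥-elim (no-1+1+1+2 t≢1 fixed-x xp xq xz₀ xz fp fq fz₀ mz
                  (≢-sym q≢p) (λ { refl → gz₀≢r gp }) (λ { refl → gz₀≢r gq }))

            contradiction : ⊥
            contradiction = thin-rows xf xf′ xz f≢f′ (≢-sym mz) (fixed-row xf fixed-f) (fixed-row xf′ fixed-f′)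
              (rel-from-fixed fixed-f (fixed-row xf fixed-f)) (rel-from-fixed fixed-f′ (fixed-row xf′ fixed-f′))

          abstract
            none-fixed : ∀ {z} → rel x z ≡ t → Moved z
            none-fixed {z₀} xz₀ fz₀ =
              let z , (xz , az) , z≢ = more-in-row (rel a z₀) (z₀ ∷ []) xa (column-twice xz₀ fz₀)
              in FixedColumn.contradiction xz₀ fz₀ xz (lookup z≢ (here refl)) refl az

          module _ {z} (xz : rel x z ≡ t) where
            abstract
              distinct : rel f z ≢ rel f′ z
              distinct fz≡f′z = thin-rows xf xf′ xz f≢f′ (≢-sym (none-fixed xz)) refl (sym fz≡f′z)
                (rel-from-fixed fixed-f refl) (rel-from-fixed fixed-f′ (sym fz≡f′z))

            -- As `g` is fixed, its row has the same entry at `z` and `τ z`; so this entry also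
            -- occurs twice in column `z`.
            attained : ∀ {g h} → Fixed g → rel x g ≡ s → rel h z ≢ rel g z →
                       ∃ λ b → rel x b ≡ s × b ≢ g × b ≢ h × rel b z ≡ rel g z
            attained {g} {h} fg xg hz≢gz =
              let b , (xb , bz) , b≢ = more-in-column (rel g z) (g ∷ []) xz
                    (row-bound (rel g z) xg ((≢-sym (none-fixed xz) ∷ []) ∷ [] ∷ [])
                      ((xz , refl) ∷ (rel-from-fixed fixed-x xz , rel-from-fixed fg refl) ∷ []))
              in b , xb , lookup b≢ (here refl) , (λ b≡h → hz≢gz (trans (cong (λ c → rel c z) (sym b≡h)) bz)) , bz

            record Split : Set where
              field
                p       : Fin n
                p-orbit : p ≡ a ⊎ p ≡ τ a
                pz      : rel p z ≡ rel f z
                τpz     : rel (τ p) z ≡ rel f′ z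

            abstract
              -- The second occurrences of the entries of `f` and `f′` must be in the rows of the
              -- orbit of `a`, and in different ones since the entries differ.
              split : Split
              split =
                let b , xb , b≢f , b≢f′ , bz = attained fixed-f xf (≢-sym distinct)
                    c , xc , c≢f′ , c≢f , cz = attained fixed-f′ xf′ distinct
                in cases bz cz (pair xb b≢f b≢f′) (pair xc c≢f c≢f′)
                where
                cases : ∀ {b c} → rel b z ≡ rel f z → rel c z ≡ rel f′ z → b ≡ a ⊎ b ≡ τ a → c ≡ a ⊎ c ≡ τ a → Split
                cases bz cz (inj₁ refl) (inj₁ refl) = ⊥-elim (distinct (trans (sym bz) cz))
                cases bz cz (inj₁ refl) (inj₂ refl) = record { p = a ; p-orbit = inj₁ refl ; pz = bz ; τpz = cz }
                cases bz cz (inj₂ refl) (inj₁ refl) = record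
                  { p = τ a ; p-orbit = inj₂ refl ; pz = bz ; τpz = subst (λ v → rel v z ≡ rel f′ z) (sym (involutive a)) cz }
                cases bz cz (inj₂ refl) (inj₂ refl) = ⊥-elim (distinct (trans (sym bz) cz))

            abstract
              orbit-values : ∀ {b} → b ≡ a ⊎ b ≡ τ a → rel b z ≡ rel f z ⊎ rel b z ≡ rel f′ z
              orbit-values = values split
                where
                values : ∀ {b} → Split → b ≡ a ⊎ b ≡ τ a → rel b z ≡ rel f z ⊎ rel b z ≡ rel f′ z
                values record { p-orbit = inj₁ refl ; pz = pz } (inj₁ refl) = inj₁ pz
                values record { p-orbit = inj₂ refl ; pz = pz } (inj₂ refl) = inj₁ pz
                values record { p-orbit = inj₁ refl ; τpz = τpz } (inj₂ refl) = inj₂ τpz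
                values record { p-orbit = inj₂ refl ; τpz = τpz } (inj₁ refl) =
                  inj₂ (subst (λ v → rel v z ≡ rel f′ z) (involutive a) τpz)

      module _ {s x f f′ a} (m : Mixed s x f f′ a) where
        open Mixed m

        abstract
          -- The five-point class is seen from `x`, `f` and `f′`, each time with the orbit of `a`.
          -- From `x`, some `p` in this orbit agrees with `f` at `z`; from `f`, it agrees with `x`
          -- or `f′`. So two of the three fixed points agree at `z`, which `distinct` forbids.
          mixed-clique : Clique s → d ≥ 4 → ⊥
          mixed-clique s-clique d≥4 with escape x (s ∷ []) (≤-trans (n≤1+n 3) d≥4)
          ... | z , xz≢1 , xz≢s ∷ [] = absurd
            where
            open Clique s-clique
            open Closed closed
            outside : ¬ One-or s (rel x z)
            outside (inj₁ xz≡1) = xz≢1 xz≡1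
            outside (inj₂ xz≡s) = xz≢s xz≡s
            outside-from : ∀ {g} → rel x g ≡ s → ¬ One-or s (rel g z)
            outside-from xg K-gz = outside (K-trans (inj₂ xg) K-gz)
            at-f : Mixed s f x f′ a
            at-f = record { s≢1 = s≢1 ; fixed-x = fixed-f ; fixed-f = fixed-x ; fixed-f′ = fixed-f′ ; moved-a = moved-a
                          ; f≢f′ = rel⇒≢ s≢1 xf′ ; xf = reverse xf ; xf′ = triangle xf xf′ f≢f′
                          ; xa = triangle xf xa (fixed≢moved fixed-f moved-a) }
            at-f′ : Mixed s f′ x f a
            at-f′ = record { s≢1 = s≢1 ; fixed-x = fixed-f′ ; fixed-f = fixed-x ; fixed-f′ = fixed-f ; moved-a = moved-a
                           ; f≢f′ = rel⇒≢ s≢1 xf ; xf = reverse xf′ ; xf′ = triangle xf′ xf (≢-sym f≢f′)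
                           ; xa = triangle xf′ xa (fixed≢moved fixed-f′ moved-a) }
            module T {x f f′} (m : Mixed s x f f′ a) = Transversal closed m (inj₂ refl)
            absurd : ⊥
            absurd with T.split m outside refl
            ... | record { p-orbit = p∈ ; pz = pz } with T.orbit-values at-f (outside-from xf) refl p∈
            ...   | inj₁ pz≡xz  = T.distinct at-f′ (outside-from xf′) refl (trans (sym pz≡xz) pz)
            ...   | inj₂ pz≡f′z = T.distinct m outside refl (trans (sym pz) pz≡f′z)

      -- Mixed sets in the lattice.

      module MixedQuad {s u v x f f′ a} (quad : Quad s u v) (m : Mixed s x f f′ a) where
        open Quad quad hiding (s≢1)
        open Mixed m

        f≢a : f ≢ a
        f≢a = fixed≢moved fixed-f moved-a

        f≢τa : f ≢ τ a
        f≢τa = fixed≢moved fixed-f (moved-image moved-a)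

        af : rel a f ≡ u
        af = μ≥2⇒u (≢⇒rel≢one (≢-sym f≢a)) (subst (2 ≤_) (between-card s (rel a f) xf)
          (length≤card (between? s (rel a f) x f) ((≢-sym moved-a ∷ []) ∷ [] ∷ [])
            ((xa , refl) ∷ (xτa , rel-to-fixed fixed-f refl) ∷ [])))

        -- The two `u`-neighbours of `f` in the 4-cycle `x s` are already `a` and `τ a`.
        ff′ : rel f f′ ≡ v
        ff′ with cover xf xf′ f≢f′
        ... | inj₂ ff′≡v = ff′≡v
        ... | inj₁ ff′≡u = ⊥-elim (two-u xf xf′ xa xτa (u-rev ff′≡u) af (rel-to-fixed fixed-f af)
          (fixed≢moved fixed-f′ moved-a) (fixed≢moved fixed-f′ (moved-image moved-a)) (≢-sym moved-a))

      abstract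
        -- In the lattice with x = 0, f = 1, f′ = -1 and a = i, the points are e = 2 + i and b = 1 +
        -- 2i. If `b` were fixed, then `f` and `b` would have the three common `u`-neighbours `a`,
        -- `τ a` and `e`.
        mixed-diagonal : ∀ {s u v x f f′ a} → Quad s u v → Mixed s x f f′ a → ∃₂ λ o b → Mixed v f f′ o b
        mixed-diagonal {s} {u} {v} {x} {f} {f′} {a} quad m =
          let w , next = next-quad quad
              e , (fe , ea) , e≢τa = another (between? u v f a) (τ a ∷ [])
                (subst (1 <_) (sym (trans (between-card u v (u-rev af)) (Quad.μ-u next))) ≤-refl)
              b , (ba , be) , b≢f = another (common? u a e) (f ∷ [])
                (subst (1 <_) (sym (trans (common-card u≢1 v≢1 (v-rev ea)) (Quad.μ-u next))) ≤-refl)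
              e≢a = rel⇒≢ v≢1 ea
              f≢b = ≢-sym (lookup b≢f (here refl))
              fb : rel f b ≡ v
              fb = Quad.two-common next f≢b (≢-sym e≢a) af (u-rev ba) (u-rev fe) (u-rev be)
              o , m′ = mixed fixed-f fixed-f′
                (λ b-fixed → Quad.three-common next f≢b (≢-sym e≢a) (≢-sym moved-a) (lookup e≢τa (here refl))
                  af (u-rev ba) (u-rev fe) (u-rev be) (rel-to-fixed fixed-f af) (u-rev (rel-from-fixed b-fixed ba)))
                ff′ fb
          in o , b , m′
          where
          open Quad quad hiding (s≢1)
          open Mixed m
          open MixedQuad quad m

      module SymmetricQuad {s u v} (quad : Quad s u v) (s-symmetric : s ᵗ ≡ s) where
        open Quad quad

        s-rev : ∀ {x y} → rel x y ≡ s → rel y x ≡ s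
        s-rev xy = trans (flipped xy) s-symmetric

        -- y is the fourth vertex of the square with sides f x and x a.
        record Corner (x f a : Fin n) : Set where
          field
            y       : Fin n
            fy      : rel f y ≡ s
            ya      : rel y a ≡ s
            xy      : rel x y ≡ u
            moved-y : Moved y
            x≢y     : x ≢ y

        abstract
          corner : ∀ {x f f′ a} → Mixed s x f f′ a → Corner x f a
          corner {x} {f} {f′} {a} m with another (common? s f a) (x ∷ [])
              (subst (1 <_) (sym (trans (common-card s≢1 u≢1 (u-rev (MixedQuad.af quad m))) μ-u)) ≤-refl)
          ... | y , (yf , ya) , y≢x ∷ [] = record
            { y = y ; fy = s-rev yf ; ya = ya ; x≢y = ≢-sym y≢x
            ; xy = two-common (≢-sym y≢x) f≢a (s-rev xf) (s-rev yf) (s-rev xa) (s-rev ya)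
            -- A fixed `y` would be `s`-related to `τ a` as well, giving `x` and `y` the three
            -- common neighbours `f`, `a`, `τ a`.
            ; moved-y = λ y-fixed → three-common (≢-sym y≢x) f≢a f≢τa (≢-sym moved-a)
                (s-rev xf) (s-rev yf) (s-rev xa) (s-rev ya) (s-rev xτa) (s-rev (rel-from-fixed y-fixed ya))
            }
            where
            open Mixed m hiding (s≢1)
            open MixedQuad quad m using (f≢a; f≢τa)

      -- In the lattice picture x = (0,0), f = (1,0), a = (0,1), y = (1,1), o = (2,0), g = (2,1) and τ is the
      -- reflection in the horizontal axis. Since x has the same relation to g and τ g,
      -- g is u-related to another point of x s, and the lattice is 3-periodic.
      module Lattice {s u v w x f f′ a} (quad : Quad s u v) (next : Quad u v w) (s-symmetric : s ᵗ ≡ s)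
                     (m : Mixed s x f f′ a) where
        open Quad quad hiding (s≢1)
        open SymmetricQuad quad s-symmetric
        open Mixed m
        open MixedQuad quad m
        open Corner (corner m)

        side : ∃ λ o → Mixed s f x o y
        side = mixed fixed-f fixed-x moved-y (s-rev xf) fy

        o : Fin n
        o = proj₁ side
        m′ : Mixed s f x o y
        m′ = proj₂ side

        fo : rel f o ≡ s
        fo = Mixed.xf′ m′

        fixed-o : Fixed o
        fixed-o = Mixed.fixed-f′ m′

        x≢o : x ≢ o
        x≢o = Mixed.f≢f′ m′

        y≢o : y ≢ o
        y≢o = ≢-sym (fixed≢moved fixed-o moved-y)

        open Corner (corner (Mixed.exchange m′)) using ()
          renaming (y to g; fy to og; ya to gy; xy to fg; moved-y to moved-g)

        -- Otherwise `μ s v` would be `μ u v`, which is 2, and `v` would equal `u`.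
        s≢u : s ≢ u
        s≢u refl = u≢v (sym (μ≥2⇒u v≢1 (≤-reflexive (sym (Quad.μ-u next)))))

        fa : rel f a ≡ u
        fa = u-rev af

        ao≢s : rel a o ≢ s
        ao≢s ao = three-common f≢a x≢y x≢o y≢o xf xa (s-rev fy) ya (s-rev fo) (s-rev ao)

        a≢g : a ≢ g
        a≢g a≡g = ao≢s (subst (λ b → rel b o ≡ s) (sym a≡g) (s-rev og))

        a≢τg : a ≢ τ g
        a≢τg a≡τg = ao≢s (subst (λ b → rel b o ≡ s) (sym a≡τg) (rel-to-fixed fixed-o (s-rev og)))

        four-u : Unique (a ∷ τ a ∷ g ∷ τ g ∷ [])
        four-u = moved-pair moved-g a≢g a≢τg moved-a

        q : Fin d
        q = rel x g

        q≢1 : q ≢ one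
        q≢1 = ≢⇒rel≢one (separated s≢u (s-rev xf) fg)

        second-edge : ∃ λ h → (rel x h ≡ s × rel h g ≡ u) × All (h ≢_) (f ∷ [])
        second-edge = another (between? s u x g) (f ∷ []) (subst (1 <_) (sym (between-card s u refl))
          (subst (1 <_) (row-card u s≢1 q≢1 xf) (length≤card (row? q u x f) ((≢-sym moved-g ∷ []) ∷ [] ∷ [])
            ((refl , fg) ∷ (rel-from-fixed fixed-x refl , rel-from-fixed fixed-f fg) ∷ []))))

        f′a : rel f′ a ≡ u
        f′a = u-rev (MixedQuad.af quad exchange)

        -- Otherwise `f u` and `f′ u` would both consist of `a`, `τ a`, `g` and `τ g`.
        f′g≢u : rel f′ g ≢ u
        f′g≢u f′g = <⇒≱ ≤-refl (no-twins u≢1 f≢f′ four-u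
          ((fa , f′a) ∷ (rel-from-fixed fixed-f fa , rel-from-fixed fixed-f′ f′a)
           ∷ (fg , f′g) ∷ (rel-from-fixed fixed-f fg , rel-from-fixed fixed-f′ f′g) ∷ []))

        u-orbit : ∀ {h} → h ≡ a ⊎ h ≡ τ a → rel f h ≡ u
        u-orbit (inj₁ refl) = fa
        u-orbit (inj₂ refl) = rel-from-fixed fixed-f fa

        -- The second `u`-neighbour `h` of `g` in `x s` is in the orbit of `a`, so `f` and `h` are
        -- `u`-related. Both lie in the 4-cycle `g u`, where only `v` and `w` occur.
        u≡w : u ≡ w
        u≡w with second-edge
        ... | h , (xh , hg) , h≢f ∷ [] with u-orbit (pair xh h≢f (λ { refl → f′g≢u hg }))
        ...   | fh≡u with Quad.cover next (u-rev fg) (u-rev hg) (≢-sym h≢f)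
        ...     | inj₁ fh≡v = ⊥-elim (u≢v (trans (sym fh≡u) fh≡v))
        ...     | inj₂ fh≡w = trans (sym fh≡u) fh≡w

        periodic : Quad u v u × Quad v u v
        periodic with next-quad (subst (Quad u v) (sym u≡w) next)
        ... | w′ , quad′ = first , subst (Quad v u) w′≡v quad′
          where
          first : Quad u v u
          first = subst (Quad u v) (sym u≡w) next
          -- One more `next-quad` gives `μ u w′` = 2, and `v` is the only relation with this
          -- property.
          w′≡v : w′ ≡ v
          w′≡v = Quad.μ≥2⇒u first (Quad.v≢1 quad′) (≤-reflexive (sym (Quad.μ-u (proj₂ (next-quad quad′)))))

      -- The 3-periodic lattice: classes of nine points.

      module Grid {A B} (quad-A : Quad A B A) (quad-B : Quad B A B) where
        open Quad quad-A using () renaming (s≢1 to A≢1; v-symmetric to A-symmetric; v-rev to A-rev)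
        open Quad quad-B using () renaming (s≢1 to B≢1; v-symmetric to B-symmetric; v-rev to B-rev; u≢v to A≢B)

        K : Fin d → Set
        K r = r ≡ one ⊎ r ≡ A ⊎ r ≡ B

        inter-symmetric : ∀ {s r} → s ᵗ ≡ s → s ≢ one → r ≢ one → inter s s r ≡ μ s r
        inter-symmetric {s} {r} s-sym s≢1 r≢1 =
          let p , q , pq = nonempty r
          in trans (sym (between-card s s pq)) (trans
               (card-cong (between? s s p q) (common? s p q) (λ (pz , zq) → trans (flipped pz) s-sym , zq)
                                                             (λ (zp , zq) → trans (flipped zp) s-sym , zq))
               (common-card s≢1 r≢1 pq))

        -- Two points of `y B` are `A`-related to `x` and two are `B`-related to it, which leaves no
        -- room for another `z`.
        cross : ∀ {x y z} → rel y x ≡ A → rel y z ≡ B → rel x z ≡ A ⊎ rel x z ≡ B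
        cross {x} {y} {z} yx yz with rel x z ≟ᶠ A | rel x z ≟ᶠ B
        ... | yes xz≡A | _        = inj₁ xz≡A
        ... | no  _    | yes xz≡B = inj₂ xz≡B
        ... | no  xz≢A | no  xz≢B = ⊥-elim (
          let l , l≡ , ul , ql = choose (row? B A y x) 2 (≤-reflexive (sym (trans (row-card A A≢1 B≢1 yx)
                                   (trans (inter-symmetric A-symmetric A≢1 B≢1) (Quad.μ-u quad-A)))))
              m , m≡ , um , qm = choose (row? B B y x) 2 (≤-reflexive (sym (trans (row-card′ B B yx)
                                   (trans (cong (λ b → inter B b A) B-symmetric)
                                   (trans (inter-symmetric B-symmetric B≢1 A≢1) (Quad.μ-u quad-B))))))
              w , w∈l , w∈zm = share (out? B y) ul (All-map proj₁ ql)
                (All-map (λ (_ , xw) z≡w → xz≢B (trans (cong (rel x) z≡w) xw)) qm ∷ um) (yz ∷ All-map proj₁ qm)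
                (subst₂ _<_ (sym (out-card B≢1 y)) (sym (cong₂ (λ i j → i + suc j) l≡ m≡)) ≤-refl)
          in clash qm (proj₂ (lookup ql w∈l)) w∈zm)
          where
          clash : ∀ {m w} → All (λ w → rel y w ≡ B × rel x w ≡ B) m → rel x w ≡ A → ¬ (w ∈ z ∷ m)
          clash qm xw (here refl) = xz≢A xw
          clash qm xw (there w∈m) = A≢B (trans (sym xw) (proj₂ (lookup qm w∈m)))

        closed : Closed K
        closed = record
          { K?      = λ r → (r ≟ᶠ one) ⊎-dec ((r ≟ᶠ A) ⊎-dec (r ≟ᶠ B))
          ; K-one   = inj₁ refl
          ; K-sym   = K-sym
          ; K-trans = K-trans
          }
          where
          K-sym : ∀ {x y} → K (rel x y) → K (rel y x)
          K-sym {x} {y} (inj₁ xy) = inj₁ (trans (cong (rel y) (rel-one xy)) (rel-refl y))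
          K-sym (inj₂ (inj₁ xy)) = inj₂ (inj₁ (A-rev xy))
          K-sym (inj₂ (inj₂ xy)) = inj₂ (inj₂ (B-rev xy))
          fork : ∀ {x y z} → x ≢ z → rel y x ≡ A ⊎ rel y x ≡ B → rel y z ≡ A ⊎ rel y z ≡ B → rel x z ≡ A ⊎ rel x z ≡ B
          fork x≢z (inj₁ yx) (inj₁ yz) = swap (Quad.cover quad-A yx yz x≢z)
          fork x≢z (inj₁ yx) (inj₂ yz) = cross yx yz
          fork x≢z (inj₂ yx) (inj₁ yz) = map-⊎ A-rev B-rev (cross yz yx)
          fork x≢z (inj₂ yx) (inj₂ yz) = Quad.cover quad-B yx yz x≢z
          K-trans : ∀ {x y z} → K (rel x y) → K (rel y z) → K (rel x z)
          K-trans {z = z} (inj₁ xy) K-yz = subst (λ w → K (rel w z)) (sym (rel-one xy)) K-yz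
          K-trans {x} K-xy@(inj₂ _) (inj₁ yz) = subst (λ w → K (rel x w)) (rel-one yz) K-xy
          K-trans {x} {y} {z} (inj₂ xy) (inj₂ yz) with x ≟ᶠ z
          ... | yes refl = inj₁ (rel-refl x)
          ... | no  x≢z  = inj₂ (fork x≢z (map-⊎ A-rev B-rev xy) yz)

        open Closed closed

        -- In the 3×3 grid x + {0, ±f} × {0, ±a} each row contains exactly one point t-related to a point z
        -- outside; but no relation from z meets a class of K in exactly three points.
        module _ {x f f′ a z} (m : Mixed B x f f′ a) (¬K-xz : ¬ K (rel x z)) where
          open Mixed m
          open SymmetricQuad quad-B B-symmetric using (Corner; corner)

          ff′ : rel f f′ ≡ B
          ff′ = MixedQuad.ff′ quad-B m

          module C  = Corner (corner m)
          module C′ = Corner (corner exchange)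

          -- By periodicity `f` and `f′` are again `B`-related, so the sets of all three points `x`,
          -- `f`, `f′` are mixed and contain the other two.
          at-f : Mixed B f x f′ C.y
          at-f = record { s≢1 = B≢1 ; fixed-x = fixed-f ; fixed-f = fixed-x ; fixed-f′ = fixed-f′ ; moved-a = C.moved-y
                        ; f≢f′ = rel⇒≢ B≢1 xf′ ; xf = B-rev xf ; xf′ = ff′ ; xa = C.fy }

          at-f′ : Mixed B f′ x f C′.y
          at-f′ = record { s≢1 = B≢1 ; fixed-x = fixed-f′ ; fixed-f = fixed-x ; fixed-f′ = fixed-f ; moved-a = C′.moved-y
                         ; f≢f′ = rel⇒≢ B≢1 xf ; xf = B-rev xf′ ; xf′ = B-rev ff′ ; xa = C′.fy }

          module T {x f f′ a} (m : Mixed B x f f′ a) = Transversal closed m (inj₂ (inj₂ refl))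

          outside : ∀ {g} → rel x g ≡ B → ¬ K (rel g z)
          outside xg K-gz = ¬K-xz (K-trans (inj₂ (inj₂ xg)) K-gz)

          t : Fin d
          t = rel x z

          t≢1 : t ≢ one
          t≢1 = ¬K-xz ∘ inj₁

          t≢fz : t ≢ rel f z
          t≢fz = T.distinct at-f′ (outside xf′) refl

          t≢f′z : t ≢ rel f′ z
          t≢f′z = T.distinct at-f (outside xf) refl

          open T.Split at-f (T.split at-f (outside xf) refl) using ()
            renaming (p to y; p-orbit to y-orbit; pz to yz; τpz to τyz)
          open T.Split at-f′ (T.split at-f′ (outside xf′) refl) using ()
            renaming (p to h; p-orbit to h-orbit; pz to hz; τpz to τhz)

          orbit-rel : ∀ {g b p r} → Fixed g → p ≡ b ⊎ p ≡ τ b → rel g b ≡ r → rel g p ≡ r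
          orbit-rel fg (inj₁ refl) gb = gb
          orbit-rel fg (inj₂ refl) gb = rel-from-fixed fg gb

          orbit-moved : ∀ {b p} → p ≡ b ⊎ p ≡ τ b → Moved b → Moved p
          orbit-moved (inj₁ refl) mb = mb
          orbit-moved (inj₂ refl) mb = moved-image mb

          xy : rel x y ≡ A
          xy = orbit-rel fixed-x y-orbit C.xy

          xh : rel x h ≡ A
          xh = orbit-rel fixed-x h-orbit C′.xy

          -- A common value would be a second point, beside `x`, that is `B`-related to both `f` and
          -- `f′`, making these `A`-related.
          separate : ∀ {v w} → rel x v ≡ A → rel f v ≡ B → rel f′ w ≡ B → v ≢ w
          separate {v} xv fv f′w v≡w = A≢B (trans (sym (Quad.two-common quad-B f≢f′ (rel⇒≢ A≢1 xv)
            xf xf′ (B-rev fv) (B-rev (trans (cong (rel f′) v≡w) f′w)))) ff′)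

          y≢h : y ≢ h
          y≢h = separate xy (orbit-rel fixed-f y-orbit C.fy) (orbit-rel fixed-f′ h-orbit C′.fy)

          y≢τh : y ≢ τ h
          y≢τh = separate xy (orbit-rel fixed-f y-orbit C.fy)
            (rel-from-fixed fixed-f′ (orbit-rel fixed-f′ h-orbit C′.fy))

          grid-points : Unique (y ∷ τ y ∷ h ∷ τ h ∷ [])
          grid-points = moved-pair (orbit-moved h-orbit C′.moved-y) y≢h y≢τh (orbit-moved y-orbit C.moved-y)

          -- `x A` is {`y`, `τ y`, `h`, `τ h`}, where the images have the entries of `f′` and `f`;
          -- in `x B` all four points have one of these two entries. Neither entry is `t`.
          only-three : ∀ {w} → rel w z ≡ t → w ≢ x → w ≢ y → w ≢ h → ¬ K (rel x w)
          only-three wz w≢x w≢y w≢h (inj₁ xw) = w≢x (sym (rel-one xw))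
          only-three wz w≢x w≢y w≢h (inj₂ (inj₁ xw)) = too-many (out? A x) (out-card A≢1 x)
            ((w≢y ∷ separated′ t≢f′z wz τyz ∷ w≢h ∷ separated′ t≢fz wz τhz ∷ []) ∷ grid-points)
            (xw ∷ xy ∷ rel-from-fixed fixed-x xy ∷ xh ∷ rel-from-fixed fixed-x xh ∷ []) ≤-refl
          only-three wz w≢x w≢y w≢h (inj₂ (inj₂ xw)) =
            values (T.orbit-values m ¬K-xz refl (pair xw (separated′ t≢fz wz refl) (separated′ t≢f′z wz refl)))
            where
            values : _ ≡ rel f z ⊎ _ ≡ rel f′ z → ⊥
            values (inj₁ wz≡fz)  = t≢fz (trans (sym wz) wz≡fz)
            values (inj₂ wz≡f′z) = t≢f′z (trans (sym wz) wz≡f′z)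

          three : Unique (x ∷ y ∷ h ∷ [])
          three = (rel⇒≢ A≢1 xy ∷ rel⇒≢ A≢1 xh ∷ []) ∷ (y≢h ∷ []) ∷ [] ∷ []

          grid-absurd : ⊥
          grid-absurd =
            -- The fourth point `w` that is `t`-related to `z` lies in another class. The path from
            -- `x` through `y` to `z` has a counterpart from `w`, whose middle point `v` is a fifth.
            let w , wz , w≢ = another (in? t z) (x ∷ y ∷ h ∷ []) (subst (3 <_) (sym (in-card t≢1 z)) ≤-refl)
                w≢x = lookup w≢ (here refl)
                ¬K-xw = only-three wz w≢x (lookup w≢ (there (here refl))) (lookup w≢ (there (there (here refl))))
                v , (wv , vz) , _ = another (between? A t w z) [] (subst (0 <_) (trans (between-card A t refl) (sym (between-card A t wz)))
                  (length≤card (between? A t x z) ([] ∷ []) ((xy , yz) ∷ [])))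
            in too-many (in? t z) (in-card t≢1 z)
                 ((≢-sym (rel⇒≢ A≢1 wv)
                   ∷ (λ v≡x → ¬K-xw (inj₂ (inj₁ (A-rev (subst (λ u → rel w u ≡ A) v≡x wv)))))
                   ∷ far ¬K-xw wv xy ∷ far ¬K-xw wv xh ∷ []) ∷ w≢ ∷ three)
                 (vz ∷ wz ∷ refl ∷ yz ∷ hz ∷ []) ≤-refl
            where
            far : ∀ {v w p} → ¬ K (rel x w) → rel w v ≡ A → rel x p ≡ A → v ≢ p
            far ¬K-xw wv xp refl = ¬K-xw (K-trans (inj₂ (inj₁ xp)) (inj₂ (inj₁ (A-rev wv))))

        mixed-grid : ∀ {x f f′ a} → Mixed B x f f′ a → d ≥ 4 → ⊥
        mixed-grid {x} m d≥4 =
          let z , xz≢1 , xz≢ = escape x (A ∷ B ∷ []) d≥4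
          in grid-absurd {z = z} m (λ
               { (inj₁ xz)        → xz≢1 xz
               ; (inj₂ (inj₁ xz)) → lookup xz≢ (here refl) xz
               ; (inj₂ (inj₂ xz)) → lookup xz≢ (there (here refl)) xz })

      -- Exclusion of mixed sets and the end of the involutive case.

      mixed-absurd : ∀ {s x f f′ a} → Mixed s x f f′ a → d ≥ 4 → ⊥
      mixed-absurd {s} {x} {f} {f′} {a} m d≥4 = cases (μ-dichotomy s≢1 (≢⇒rel≢one a≢f)
        (subst (2 ≤_) (between-card s (rel a f) xf) (length≤card (between? s (rel a f) x f)
          ((≢-sym moved-a ∷ []) ∷ [] ∷ []) ((xa , refl) ∷ (xτa , rel-to-fixed fixed-f refl) ∷ []))))
        where
        open Mixed m
        a≢f : a ≢ f
        a≢f = ≢-sym (fixed≢moved fixed-f moved-a)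
        grid : ∀ {s u v w x f f′ a} → Quad s u v → Quad u v w → s ᵗ ≡ s → Mixed s x f f′ a → ⊥
        -- Only `u` and `v` occur between distinct points of `x s`, so `absorb` puts `s` into
        -- {`one`, `u`, `v`}; what remains is `s` = `v`, the side of the grid.
        grid {s} {u} {v} quad next s-sym m = located (absorb closed block)
          where
          quad-A = proj₁ (Lattice.periodic quad next s-sym m)
          quad-B = proj₂ (Lattice.periodic quad next s-sym m)
          open Grid quad-A quad-B
          block : ∀ {x y z} → rel x y ≡ s → rel x z ≡ s → K (rel y z)
          block {x} {y} {z} xy xz with y ≟ᶠ z
          ... | yes refl = inj₁ (rel-refl y)
          ... | no  y≢z  = inj₂ (Quad.cover quad xy xz y≢z)
          located : K s → ⊥
          located (inj₁ s≡1)        = Quad.s≢1 quad s≡1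
          located (inj₂ (inj₁ s≡u)) = Lattice.s≢u quad next s-sym m s≡u
          located (inj₂ (inj₂ s≡v)) = mixed-grid (subst (λ s → Mixed s _ _ _ _) s≡v m) d≥4
        cases : (s ≡ rel a f × Clique (rel a f)) ⊎ ∃ (Quad s (rel a f)) → ⊥
        cases (inj₁ (s≡u , clique)) = mixed-clique m (subst Clique (sym s≡u) clique) d≥4
        cases (inj₂ (v , quad)) =
          -- The lattice argument is for a symmetric relation. The diagonal `v` is symmetric, so the
          -- mixed set and the quad are moved from `s` to `v`.
          let o , b , m′ = mixed-diagonal quad m
              w , quad₁  = next-quad quad
              w′ , quad₂ = next-quad quad₁
              _ , quad₃  = next-quad quad₂
          in grid quad₂ quad₃ (Quad.v-symmetric quad) m′

      module _ (d≥4 : d ≥ 4) where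
        no-mixed : ∀ {x f a} → Fixed x → Fixed f → rel x f ≡ rel x a → Fixed a
        no-mixed {a = a} fx ff xf≡xa = decidable-stable (τ a ≟ᶠ a) λ ma →
          mixed-absurd (proj₂ (mixed fx ff ma xf≡xa refl)) d≥4

        module _ {x f a} (x≢f : x ≢ f) (fx : Fixed x) (ff : Fixed f) (ma : Moved a) where
          s t r p : Fin d
          s = rel x f
          t = rel x a
          r = rel f a
          p = rel a (τ a)

          s≢1 : s ≢ one
          s≢1 = ≢⇒rel≢one x≢f
          t≢1 : t ≢ one
          t≢1 = ≢⇒rel≢one (fixed≢moved fx ma)
          r≢1 : r ≢ one
          r≢1 = ≢⇒rel≢one (fixed≢moved ff ma)
          p≢1 : p ≢ one
          p≢1 = ≢⇒rel≢one (≢-sym ma)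

          -- Between `x s` and `x t`, the row of `f` has the entry `r` at `a` and `τ a`; so the
          -- column of `a` also has it twice.
          twin : ∃ λ g → (rel x g ≡ s × rel g a ≡ r) × All (g ≢_) (f ∷ [])
          twin = another (between? s r x a) (f ∷ []) (subst (1 <_) (trans (row-card r s≢1 t≢1 refl) (sym (between-card s r refl)))
            (length≤card (row? t r x f) ((≢-sym ma ∷ []) ∷ [] ∷ [])
              ((refl , refl) ∷ (rel-from-fixed fx refl , rel-from-fixed ff refl) ∷ [])))

          module _ {g} (fg : Fixed g) (ga : rel g a ≡ r) (f≢g : f ≢ g) where
            gτa : rel g (τ a) ≡ r
            gτa = rel-from-fixed fg ga

            clique-case : r ≡ p × Clique p → ⊥
            clique-case (r≡p , clique) = ma (no-mixed ff fg (triangle (reverse refl) (reverse ga) f≢g))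
              where open Clique (subst Clique (sym r≡p) clique)

            fgᵗ : 2 ≤ μ (r ᵗ) (rel f g)
            fgᵗ = subst (2 ≤_) (shared-card r≢1 (≢⇒rel≢one f≢g) refl)
              (length≤card (shared? r f g) ((≢-sym ma ∷ []) ∷ [] ∷ [])
                ((refl , ga) ∷ (rel-from-fixed ff refl , gτa) ∷ []))

            -- `c` is the second `p`-neighbour of `τ a` in the 4-cycle `f r`, and `b` the second
            -- point whose set `b r` contains `τ a` and `c`. If `b` were fixed, `b r` would equal
            -- `f r`. But by `quad-ᵗ` only one relation allows two common points, so `b` is related
            -- to `f` as the fixed point `g` is, and `no-mixed` makes it fixed.
            quad-case : ∃ (Quad r p) → ⊥
            quad-case (v , quad) =
              let c , (fc , cτa) , c≢ = another (between? r p f (τ a)) (a ∷ [])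
                    (subst (1 <_) (sym (trans (between-card r p (rel-from-fixed ff refl)) μ-u)) ≤-refl)
                  b , (bτa , bc) , b≢ = another (common? r (τ a) c) (f ∷ [])
                    (subst (1 <_) (sym (trans (common-card r≢1 p≢1 (u-rev cτa)) μ-u)) ≤-refl)
              in absurd fc cτa (lookup c≢ (here refl)) bτa bc (≢-sym (lookup b≢ (here refl)))
              where
              open Quad quad using (μ-u; u-rev)
              absurd : ∀ {b c} → rel f c ≡ r → rel c (τ a) ≡ p → c ≢ a → rel b (τ a) ≡ r → rel b c ≡ r → f ≢ b → ⊥
              absurd {b} {c} fc cτa c≢a bτa bc f≢b = mb (no-mixed ff fg (sym fb≡fg))
                where
                mc : Moved c
                mc fc-fixed = ma (no-mixed ff fc-fixed fc)
                c≢τa : c ≢ τ a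
                c≢τa = rel⇒≢ p≢1 cτa
                a≢τc : a ≢ τ c
                a≢τc a≡τc = c≢τa (sym (trans (cong τ a≡τc) (involutive c)))
                ba : Fixed b → rel b a ≡ r
                ba fb = subst (λ w → rel b w ≡ r) (involutive a) (rel-from-fixed fb bτa)
                mb : Moved b
                mb fb = <⇒≱ ≤-refl (no-twins r≢1 f≢b (moved-pair mc (≢-sym c≢a) a≢τc ma)
                  ((refl , ba fb) ∷ (rel-from-fixed ff refl , bτa) ∷ (fc , bc)
                   ∷ (rel-from-fixed ff fc , rel-from-fixed fb bc) ∷ []))
                fb≡fg : rel f b ≡ rel f g
                fb≡fg = Quad.μ≥2⇒u (proj₂ (quad-ᵗ quad (≢⇒rel≢one f≢g) fgᵗ)) (≢⇒rel≢one f≢b)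
                  (subst (2 ≤_) (shared-card r≢1 (≢⇒rel≢one f≢b) refl)
                    (length≤card (shared? r f b) ((≢-sym c≢τa ∷ []) ∷ [] ∷ [])
                      ((rel-from-fixed ff refl , bτa) ∷ (fc , bc) ∷ [])))

            2≤μ : 2 ≤ μ r p
            2≤μ = subst (2 ≤_) (common-card r≢1 p≢1 refl) (length≤card (common? r a (τ a)) ((f≢g ∷ []) ∷ [] ∷ [])
              ((refl , rel-from-fixed ff refl) ∷ (ga , gτa) ∷ []))

            twin-absurd : ⊥
            twin-absurd = [ clique-case , quad-case ]′ (μ-dichotomy r≢1 p≢1 2≤μ)

          moved-absurd : ⊥
          moved-absurd =
            let g , (xg , ga) , g≢ = twin
            in twin-absurd (no-mixed fx ff (sym xg)) ga (≢-sym (lookup g≢ (here refl)))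

        all-fixed : ∀ {α β} → α ≢ β → Fixed α → Fixed β → ∀ a → Fixed a
        all-fixed α≢β fα fβ a = decidable-stable (τ a ≟ᶠ a) (moved-absurd α≢β fα fβ)

    -- Orbit lengths and the reduction to orders 3 and 2.

    -- The orbit of `a` stays in a set of four points around `α`. Lengths 1, 2 and 4 are merged into
    -- the first alternative.
    short-orbit : ∀ {α} → Fixed α → ∀ a → τ (τ (τ (τ a))) ≡ a ⊎ τ (τ (τ a)) ≡ a
    short-orbit {α} fα a with τ a ≟ᶠ a | τ (τ a) ≟ᶠ a | τ (τ (τ a)) ≟ᶠ a | τ (τ (τ (τ a))) ≟ᶠ a
    ... | yes τa≡a | _ | _ | _ = inj₁ (trans (cong (τ ∘ τ ∘ τ) τa≡a) (trans (cong (τ ∘ τ) τa≡a) (trans (cong τ τa≡a) τa≡a)))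
    ... | no _ | yes τ²a≡a | _ | _ = inj₁ (trans (cong (τ ∘ τ) τ²a≡a) τ²a≡a)
    ... | no _ | no _ | yes τ³a≡a | _ = inj₂ τ³a≡a
    ... | no _ | no _ | no _ | yes τ⁴a≡a = inj₁ τ⁴a≡a
    ... | no τa≢a | no τ²a≢a | no τ³a≢a | no τ⁴a≢a = ⊥-elim (too-many (out? (rel α a) α)
      (out-card (≢⇒rel≢one (fixed≢moved fα τa≢a)) α)
      ((≢-sym τa≢a ∷ ≢-sym τ²a≢a ∷ ≢-sym τ³a≢a ∷ ≢-sym τ⁴a≢a ∷ [])
       ∷ (shift τa≢a ∷ shift τ²a≢a ∷ shift τ³a≢a ∷ [])
       ∷ (shift (shift⁻ τa≢a) ∷ shift (shift⁻ τ²a≢a) ∷ []) ∷ (shift (shift⁻ (shift⁻ τa≢a)) ∷ []) ∷ [] ∷ [])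
      (refl ∷ step refl ∷ step (step refl) ∷ step (step (step refl)) ∷ step (step (step (step refl))) ∷ []) ≤-refl)
      where
      shift : ∀ {x y} → x ≢ y → τ y ≢ τ x
      shift x≢y τy≡τx = x≢y (sym (τ-injective τy≡τx))
      shift⁻ : ∀ {x y} → x ≢ y → τ x ≢ τ y
      shift⁻ x≢y = x≢y ∘ τ-injective
      step : ∀ {w} → rel α w ≡ rel α a → rel α (τ w) ≡ rel α a
      step = rel-from-fixed fα

    order∣12 : ∀ {α} → Fixed α → ∀ a → τ (τ (τ (τ (τ (τ (τ (τ (τ (τ (τ (τ a))))))))))) ≡ a
    order∣12 fα a with short-orbit fα a
    ... | inj₁ e = trans (cong (τ ∘ τ ∘ τ ∘ τ ∘ τ ∘ τ ∘ τ ∘ τ) e) (trans (cong (τ ∘ τ ∘ τ ∘ τ) e) e)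
    ... | inj₂ e = trans (cong (τ ∘ τ ∘ τ ∘ τ ∘ τ ∘ τ ∘ τ ∘ τ ∘ τ) e)
                     (trans (cong (τ ∘ τ ∘ τ ∘ τ ∘ τ ∘ τ) e) (trans (cong (τ ∘ τ ∘ τ) e) e))

theorem3p24 : ∀ {n d : ℕ} (S : AssocScheme n d) → FourEquivalenced S → d ≥ 4 →
    (τ : Fin n → Fin n) → IsAut S τ →
    (α β : Fin n) → ¬ (α ≡ β) → τ α ≡ α → τ β ≡ β →
    ∀ x → τ x ≡ x
theorem3p24 {n} S four d≥4 τ ((τ-injective , _) , τ-preserves) α β α≢β τα τβ =
  Automorphism.Order2.all-fixed τ τ-injective τ-rel τ²-id d≥4 α≢β τα τβ
  where
  open AssocScheme S using (rel)
  open FourEquivalencedScheme S four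
  τ² τ⁴ : Fin n → Fin n
  τ² = τ ∘ τ
  τ⁴ = τ² ∘ τ²
  τ-rel : ∀ x y → rel (τ x) (τ y) ≡ rel x y
  τ-rel x y = sym (τ-preserves x y)
  τ²-rel : ∀ x y → rel (τ² x) (τ² y) ≡ rel x y
  τ²-rel x y = trans (τ-rel (τ x) (τ y)) (τ-rel x y)
  τ²-fixes : ∀ {x} → τ x ≡ x → τ² x ≡ x
  τ²-fixes τx = trans (cong τ τx) τx
  -- The cube of `τ⁴` is trivial by `order∣12`, so `τ⁴` is the identity. Then `τ²` is an involution
  -- or trivial, hence the identity, and the same argument applies to `τ`.
  τ⁴-id : ∀ x → τ⁴ x ≡ x
  τ⁴-id = Automorphism.Order3.all-fixed τ⁴ (τ-injective ∘ τ-injective ∘ τ-injective ∘ τ-injective)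
    (λ x y → trans (τ²-rel (τ² x) (τ² y)) (τ²-rel x y))
    (Automorphism.order∣12 τ τ-injective τ-rel τα) d≥4 (trans (cong τ² (τ²-fixes τα)) (τ²-fixes τα))
  τ²-id : ∀ x → τ² x ≡ x
  τ²-id = Automorphism.Order2.all-fixed τ² (τ-injective ∘ τ-injective) τ²-rel τ⁴-id d≥4 α≢β (τ²-fixes τα) (τ²-fixes τβ)
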